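{- Let $n,d,w$ be positive integers with $d\le w\le n/2$. Then $$ A(n,2d,w)\ \ge\ \frac{\binom{n}{w}}{V(n,d-1,w)}\cdot\frac{\log_2 V(n,d-1,w)-\log_2\sqrt{e(n,d-1,w)}}{10}, $$ where $V(n,r,w)$ and $e(n,r,w)$ are as defined in the context.
   Context: $A(n,2d,w)$ is the maximum number of codewords in a binary code of length $n$, all codewords of Hamming weight $w$, with minimum Hamming distance $2d$. $V(n,r,w)=\sum_{i=0}^{r}\binom{w}{i}\binom{n-w}{i}$. For positive integers $i,j,k\le w$ with $k\le i+j$, set $$ p^k_{i,j}=\sum_{l=a}^{b}\binom{n-w-k}{l}\binom{k}{i-l}\binom{k}{j-l}\binom{w-k}{i+j-k-l}, $$ where $a=\max\{0,i-k,j-k,i+j-w\}$ and $b=\min\{i,j,i+j-k,n-w-k\}$; set $p^k_{i,j}=0$ for $k>i+j$. Define $$ e(n,r,w)=\frac16\sum_{i=1}^{r}\sum_{j=1}^{r}\sum_{k=1}^{r}\binom{w}{k}\binom{n-w}{k}p^k_{i,j}. $$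
   Formalization: The formal theorem assumes d ≥ 2: for d = 1 the sum defining e(n,0,w) is empty, so e = 0 and the logarithm of √e is undefined; the inequality is stated in the equivalent exponentiated integer form. -}

module Defs where

open import Data.Nat using (ℕ; zero; suc; _+_; _*_; _∸_; _≤_; _≤ᵇ_; _⊔_; _⊓_)
open import Data.Nat.Combinatorics using (_C_)
open import Data.Bool using (Bool; true; false; if_then_else_)
open import Data.Vec using (Vec; []; _∷_)
open import Data.List using (List; length; map; upTo)
open import Data.Nat.ListAction using (sum)
open import Data.List.Relation.Unary.All using (All)
open import Data.List.Relation.Unary.AllPairs using (AllPairs)
open import Data.Product using (Σ; _×_)
open import Relation.Binary.PropositionalEquality using (_≡_)

weight : ∀ {n} → Vec Bool n → ℕ
weight [] = 0
weight (true ∷ v) = suc (weight v)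
weight (false ∷ v) = weight v

dist : ∀ {n} → Vec Bool n → Vec Bool n → ℕ
dist [] [] = 0
dist (true ∷ x) (true ∷ y) = dist x y
dist (false ∷ x) (false ∷ y) = dist x y
dist (true ∷ x) (false ∷ y) = suc (dist x y)
dist (false ∷ x) (true ∷ y) = suc (dist x y)

-- A binary constant-weight code of length n, weight w and minimum distance
-- (at least) δ, given as a list of codewords: every codeword has weight w and
-- any two codewords at different positions of the list are at distance ≥ δ.
-- (For δ ≥ 1 this forces the codewords to be distinct, so the list is a set.)
IsCWCode : (n δ w : ℕ) → List (Vec Bool n) → Set
IsCWCode n δ w cs = All (λ x → weight x ≡ w) cs × AllPairs (λ x y → δ ≤ dist x y) cs

-- "m ≤ A(n, δ, w)": there is a constant-weight code with parameters
-- (n, δ, w) having at least m codewords.  Since A(n,δ,w) is the maximum size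
-- of such a code, this is exactly the statement m ≤ A(n,δ,w).
_≤A[_,_,_] : ℕ → ℕ → ℕ → ℕ → Set
m ≤A[ n , δ , w ] = Σ (List (Vec Bool n)) λ cs → IsCWCode n δ w cs × m ≤ length cs

-- Σ_{l=a}^{b} f l  (empty, i.e. 0, when b < a).
sumFromTo : ℕ → ℕ → (ℕ → ℕ) → ℕ
sumFromTo a b f = sum (map (λ t → f (a + t)) (upTo (suc b ∸ a)))

V : ℕ → ℕ → ℕ → ℕ
V n r w = sumFromTo 0 r (λ i → (w C i) * ((n ∸ w) C i))

p : (n w k i j : ℕ) → ℕ
p n w k i j =
  if k ≤ᵇ i + j
  then sumFromTo a b (λ l → ((n ∸ w ∸ k) C l) * (k C (i ∸ l)) * (k C (j ∸ l))
                             * ((w ∸ k) C (i + j ∸ k ∸ l)))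
  else 0
  where
  a = 0 ⊔ (i ∸ k) ⊔ (j ∸ k) ⊔ (i + j ∸ w)
  b = i ⊓ j ⊓ (i + j ∸ k) ⊓ (n ∸ w ∸ k)

sixE : ℕ → ℕ → ℕ → ℕ
sixE n r w =
  sumFromTo 1 r λ i → sumFromTo 1 r λ j → sumFromTo 1 r λ k →
    (w C k) * ((n ∸ w) C k) * p n w k i j

{-# OPTIONS --safe #-}
module Submission where

-- Lower-bound the mean size of a random independent set I of the graph on the
-- words of weight w in which words at distance < 2d are adjacent, under the
-- hard-core model at fugacity 1/q.  Condition on I outside the closed
-- neighbourhood of a vertex v, and let F be the set of neighbours of v that
-- remain free.  If F is small, v itself is chosen with good probability; if F
-- is large then, as each neighbourhood spans at most sixE/2 edges, many of its
-- vertices are chosen.  Balancing the two with q ≈ √sixE and averaging over v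
-- gives 2V|I| ≥ c N for some I, where c is the least integer with
-- V²/e ≤ 2^(10c); when c ≤ 2 a greedy independent set does.

open import Defs
open import Data.Bool using (Bool; true; false; not; _∧_; T)
open import Data.Bool.Properties using (T-≡; T-∧)
open import Data.Empty using (⊥)
open import Data.List using (List; []; _∷_; _++_; applyUpTo; filter; length; map; upTo)
open import Data.List.Properties using (map-++; map-∘; map-cong; map-upTo)
open import Data.List.Membership.Propositional using (_∈_)
open import Data.List.Membership.Propositional.Properties using (∈-map⁻; ∈-upTo⁺)
open import Data.List.Relation.Unary.All as All using (All; []; _∷_)
import Data.List.Relation.Unary.All.Properties as All
open import Data.List.Relation.Unary.AllPairs using (AllPairs; []; _∷_)
open import Data.List.Relation.Unary.Any using (here; there)
open import Data.List.Relation.Unary.Unique.Propositional using (Unique)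
import Data.List.Relation.Unary.Unique.Propositional.Properties as Unique
open import Data.List.Relation.Binary.Permutation.Propositional as Perm using (_↭_; ↭-sym; ↭-trans; prep)
open import Data.List.Relation.Binary.Permutation.Propositional.Properties using (++-comm; map⁺; shift; ∈-resp-↭)
open import Data.List.Relation.Binary.Sublist.Propositional using (_⊆_; []; _∷_; _∷ʳ_)
open import Data.List.Relation.Binary.Sublist.Propositional.Properties using (All-resp-⊆; filter-⊆)
open import Data.Nat
open import Data.Nat.Combinatorics using (_C_; nC1≡n; nCk+nC[k+1]≡[n+1]C[k+1])
open import Data.Nat.ListAction using (sum)
open import Data.Nat.ListAction.Properties using (sum-++; sum-↭)
open import Data.Nat.Properties
open import Data.Nat.Tactic.RingSolver using (solve-∀)
open import Data.Product using (Σ; ∃; ∃₂; _×_; _,_; proj₁; proj₂)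
open import Data.Sum using (_⊎_; inj₁; inj₂)
open import Data.Unit using (tt)
open import Data.Vec using (Vec; []; _∷_)
open import Data.Vec.Properties using (∷-injectiveʳ)
open import Function using (_∘_; const)
open import Function.Bundles using (Equivalence)
open import Relation.Nullary using (yes; no; does; contradiction)
open import Relation.Unary using (Decidable)
open import Relation.Binary.PropositionalEquality

-- For every vertex v the quantity D P(v ∈ I) + E|I ∩ N(v)| is shown to be at least c, where D
-- bounds the degrees. Summed over v, a member of I counts D times for itself and at most D times
-- for its neighbours, hence the factor 2. Given I outside the closed neighbourhood, with m = |F|,
-- the case v ∈ I has weight q^m and the case v ∉ I has weight q Z(F). The threshold is m =
-- (q+1)(c+1). Above it the mean size of I in F is at least m/(q+1) - sixE/(q+1)², which is at least
-- c once (q+1)² ≥ sixE. Below it (1+1/q)^(q+1) ≤ 4 keeps Z(F)/q^m so small that D ≥ q 4^(c+1) + c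
-- suffices. The integer c stands in for the logarithm, so that the argument stays in ℕ. Minimality
-- of c offers only 6V² > sixE 2^(10(c-1)): the rounding costs a full factor 2^10. This implies the
-- demand on D from c = 3 on, but would not at c = 2, which is why small c is left to the greedy
-- set.

∑ : {B : Set} → List B → (B → ℕ) → ℕ
∑ xs f = sum (map f xs)

𝟙 : Bool → ℕ
𝟙 true  = 1
𝟙 false = 0

module _ {B : Set} where

  ∑-mono : ∀ {f g : B → ℕ} {xs} → All (λ x → f x ≤ g x) xs → ∑ xs f ≤ ∑ xs g
  ∑-mono []       = z≤n
  ∑-mono (p ∷ ps) = +-mono-≤ p (∑-mono ps)

  ∑-mono′ : ∀ {f g : B → ℕ} xs → (∀ x → f x ≤ g x) → ∑ xs f ≤ ∑ xs g
  ∑-mono′ xs f≤g = ∑-mono (All.universal f≤g xs)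

  ∑-cong : ∀ {f g : B → ℕ} xs → (∀ x → f x ≡ g x) → ∑ xs f ≡ ∑ xs g
  ∑-cong xs f≡g = cong sum (map-cong f≡g xs)

  ∑-congᴬ : ∀ {f g : B → ℕ} {xs} → All (λ x → f x ≡ g x) xs → ∑ xs f ≡ ∑ xs g
  ∑-congᴬ []       = refl
  ∑-congᴬ (p ∷ ps) = cong₂ _+_ p (∑-congᴬ ps)

  ∑-+ : ∀ (f g : B → ℕ) xs → ∑ xs (λ x → f x + g x) ≡ ∑ xs f + ∑ xs g
  ∑-+ f g []       = refl
  ∑-+ f g (x ∷ xs) = trans (cong (f x + g x +_) (∑-+ f g xs)) (lem (f x) (g x) (∑ xs f) (∑ xs g))
    where
    lem : ∀ a b c d → a + b + (c + d) ≡ a + c + (b + d)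
    lem = solve-∀

  ∑-*ˡ : ∀ a (f : B → ℕ) xs → ∑ xs (λ x → a * f x) ≡ a * ∑ xs f
  ∑-*ˡ a f []       = sym (*-zeroʳ a)
  ∑-*ˡ a f (x ∷ xs) = trans (cong (a * f x +_) (∑-*ˡ a f xs)) (sym (*-distribˡ-+ a (f x) _))

  ∑-*ʳ : ∀ a (f : B → ℕ) xs → ∑ xs (λ x → f x * a) ≡ ∑ xs f * a
  ∑-*ʳ a f xs = trans (∑-cong xs (λ x → *-comm (f x) a)) (trans (∑-*ˡ a f xs) (*-comm a _))

  ∑-const : ∀ a (xs : List B) → ∑ xs (const a) ≡ length xs * a
  ∑-const a []       = refl
  ∑-const a (x ∷ xs) = cong (a +_) (∑-const a xs)

  ∑-++ : ∀ (f : B → ℕ) xs ys → ∑ (xs ++ ys) f ≡ ∑ xs f + ∑ ys f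
  ∑-++ f xs ys = trans (cong sum (map-++ f xs ys)) (sum-++ (map f xs) (map f ys))

  ∑-map : ∀ {C : Set} (f : C → ℕ) (g : B → C) xs → ∑ (map g xs) f ≡ ∑ xs (f ∘ g)
  ∑-map f g xs = cong sum (sym (map-∘ xs))

  ∑-↭ : ∀ (f : B → ℕ) {xs ys} → xs ↭ ys → ∑ xs f ≡ ∑ ys f
  ∑-↭ f p = sum-↭ (map⁺ f p)

  ∑-⊆ : ∀ (f : B → ℕ) {xs ys} → xs ⊆ ys → ∑ xs f ≤ ∑ ys f
  ∑-⊆ f []         = z≤n
  ∑-⊆ f (y ∷ʳ p)   = ≤-trans (∑-⊆ f p) (m≤n+m _ (f y))
  ∑-⊆ f (_∷_ {x} refl p) = +-monoʳ-≤ (f x) (∑-⊆ f p)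

∑-swap : ∀ {B C : Set} (f : B → C → ℕ) xs ys →
         ∑ xs (λ x → ∑ ys (f x)) ≡ ∑ ys (λ y → ∑ xs (λ x → f x y))
∑-swap f []       ys = sym (trans (∑-const 0 ys) (*-zeroʳ (length ys)))
∑-swap f (x ∷ xs) ys = trans (cong (∑ ys (f x) +_) (∑-swap f xs ys)) (sym (∑-+ (f x) _ ys))

module _ {A : Set} where

  -- Marks one occurrence and keeps the rest. Sums over `picks` express "for each vertex v, with R
  -- the other vertices" without comparing vertices.
  picks : List A → List (A × List A)
  picks []       = []
  picks (x ∷ xs) = (x , xs) ∷ map (λ (y , ys) → y , x ∷ ys) (picks xs)

  picks-↭ : ∀ xs → All (λ (u , R) → xs ↭ u ∷ R) (picks xs)
  picks-↭ []       = []
  picks-↭ (x ∷ xs) = Perm.refl ∷ All.map⁺ (All.map (λ p → ↭-trans (prep x p) (Perm.swap x _ Perm.refl)) (picks-↭ xs))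

  ∑-picks : ∀ (φ : A → ℕ) xs → ∑ (picks xs) (φ ∘ proj₁) ≡ ∑ xs φ
  ∑-picks φ []       = refl
  ∑-picks φ (x ∷ xs) = cong (φ x +_) (trans (∑-map (φ ∘ proj₁) (λ (y , ys) → y , x ∷ ys) (picks xs)) (∑-picks φ xs))

-- Weighted sums over sublists

module WeightedSum {A : Set} (q : ℕ) where

  -- The sublists K of xs are weighted by q^(|xs| - |K|), which is the hard-core
  -- weight (1/q)^|K| with denominators cleared.
  wsum : List A → (List A → ℕ) → ℕ
  wsum []       f = f []
  wsum (x ∷ xs) f = wsum xs (f ∘ (x ∷_)) + q * wsum xs f

  wsum-mono : ∀ {P : A → Set} {f g : List A → ℕ} {xs} → All P xs →
              (∀ {K} → All P K → f K ≤ g K) → wsum xs f ≤ wsum xs g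
  wsum-mono []       f≤g = f≤g []
  wsum-mono (p ∷ ps) f≤g =
    +-mono-≤ (wsum-mono ps (λ pk → f≤g (p ∷ pk))) (*-monoʳ-≤ q (wsum-mono ps f≤g))

  wsum-mono′ : ∀ {f g : List A → ℕ} xs → (∀ K → f K ≤ g K) → wsum xs f ≤ wsum xs g
  wsum-mono′ []       f≤g = f≤g []
  wsum-mono′ (x ∷ xs) f≤g =
    +-mono-≤ (wsum-mono′ xs (λ K → f≤g (x ∷ K))) (*-monoʳ-≤ q (wsum-mono′ xs f≤g))

  wsum-congᴬ : ∀ {P : A → Set} {f g : List A → ℕ} {xs} → All P xs →
               (∀ {K} → All P K → f K ≡ g K) → wsum xs f ≡ wsum xs g
  wsum-congᴬ ps f≡g =
    ≤-antisym (wsum-mono ps (λ pk → ≤-reflexive (f≡g pk))) (wsum-mono ps (λ pk → ≤-reflexive (sym (f≡g pk))))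

  wsum-cong : ∀ {f g : List A → ℕ} xs → (∀ K → f K ≡ g K) → wsum xs f ≡ wsum xs g
  wsum-cong xs f≡g =
    ≤-antisym (wsum-mono′ xs (λ K → ≤-reflexive (f≡g K))) (wsum-mono′ xs (λ K → ≤-reflexive (sym (f≡g K))))

  wsum-+ : ∀ (f g : List A → ℕ) xs → wsum xs (λ K → f K + g K) ≡ wsum xs f + wsum xs g
  wsum-+ f g []       = refl
  wsum-+ f g (x ∷ xs) = trans (cong₂ (λ a b → a + q * b) (wsum-+ (f ∘ (x ∷_)) (g ∘ (x ∷_)) xs) (wsum-+ f g xs))
                              (lem (wsum xs (f ∘ (x ∷_))) (wsum xs (g ∘ (x ∷_))) (wsum xs f) (wsum xs g) q)
    where
    lem : ∀ a b c d k → a + b + k * (c + d) ≡ a + k * c + (b + k * d)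
    lem = solve-∀

  wsum-*ˡ : ∀ a (f : List A → ℕ) xs → wsum xs (λ K → a * f K) ≡ a * wsum xs f
  wsum-*ˡ a f []       = refl
  wsum-*ˡ a f (x ∷ xs) = trans (cong₂ (λ b c → b + q * c) (wsum-*ˡ a (f ∘ (x ∷_)) xs) (wsum-*ˡ a f xs))
                               (lem a (wsum xs (f ∘ (x ∷_))) (wsum xs f) q)
    where
    lem : ∀ a b c k → a * b + k * (a * c) ≡ a * (b + k * c)
    lem = solve-∀

  wsum-const : ∀ a xs → wsum xs (const a) ≡ suc q ^ length xs * a
  wsum-const a []       = sym (+-identityʳ a)
  wsum-const a (x ∷ xs) = trans (cong (λ b → b + q * b) (wsum-const a xs)) (sym (*-assoc (suc q) (suc q ^ length xs) a))

  wsum-[] : ∀ f xs → q ^ length xs * f [] ≤ wsum xs f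
  wsum-[] f []       = ≤-reflexive (+-identityʳ (f []))
  wsum-[] f (x ∷ xs) = begin
    q * q ^ length xs * f []   ≡⟨ *-assoc q (q ^ length xs) (f []) ⟩
    q * (q ^ length xs * f []) ≤⟨ *-monoʳ-≤ q (wsum-[] f xs) ⟩
    q * wsum xs f              ≤⟨ m≤n+m _ _ ⟩
    wsum (x ∷ xs) f            ∎
    where open ≤-Reasoning

  wsum-++ : ∀ f xs ys → wsum (xs ++ ys) f ≡ wsum xs (λ K → wsum ys (λ L → f (K ++ L)))
  wsum-++ f []       ys = refl
  wsum-++ f (x ∷ xs) ys = cong₂ (λ a b → a + q * b) (wsum-++ _ xs ys) (wsum-++ f xs ys)

  -- Sublists of a permuted list come out permuted; for an invariant `f` the sum therefore depends
  -- on the vertex set alone, and a graph may be reordered around a vertex.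
  wsum-↭ : ∀ {f} → (∀ {K L} → K ↭ L → f K ≡ f L) → ∀ {xs ys} → xs ↭ ys → wsum xs f ≡ wsum ys f
  wsum-↭ inv Perm.refl = refl
  wsum-↭ inv (prep x p) = cong₂ (λ a b → a + q * b) (wsum-↭ (inv ∘ prep x) p) (wsum-↭ inv p)
  wsum-↭ {f} inv (Perm.swap {xs} {ys} x y p) = begin
    wsum xs (f ∘ (x ∷_) ∘ (y ∷_)) + q * wsum xs (f ∘ (x ∷_)) + q * (wsum xs (f ∘ (y ∷_)) + q * wsum xs f)
      ≡⟨ cong₂ _+_ (cong₂ (λ a b → a + q * b)
           (trans (wsum-cong xs (λ K → inv (Perm.swap x y Perm.refl))) (wsum-↭ (inv ∘ prep y ∘ prep x) p))
           (wsum-↭ (inv ∘ prep x) p))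
         (cong₂ (λ a b → q * (a + q * b)) (wsum-↭ (inv ∘ prep y) p) (wsum-↭ inv p)) ⟩
    wsum ys (f ∘ (y ∷_) ∘ (x ∷_)) + q * wsum ys (f ∘ (x ∷_)) + q * (wsum ys (f ∘ (y ∷_)) + q * wsum ys f)
      ≡⟨ lem _ _ _ _ q ⟩
    wsum ys (f ∘ (y ∷_) ∘ (x ∷_)) + q * wsum ys (f ∘ (y ∷_)) + q * (wsum ys (f ∘ (x ∷_)) + q * wsum ys f) ∎
    where
    open ≡-Reasoning
    lem : ∀ a b c d k → a + k * b + k * (c + k * d) ≡ a + k * c + k * (b + k * d)
    lem = solve-∀
  wsum-↭ inv (Perm.trans p p′) = trans (wsum-↭ inv p) (wsum-↭ inv p′)

  -- Double counting of sublists with a marked member: either K comes before its marked member, or u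
  -- comes before a sublist of the rest. The weights agree because a chosen member has weight 1.
  wsum-picks : ∀ (h : A → List A → ℕ) xs →
    wsum xs (λ K → ∑ (picks K) (λ (x , K′) → h x K′)) ≡ ∑ (picks xs) (λ (u , R) → wsum R (h u))
  wsum-picks h []       = refl
  wsum-picks h (x ∷ xs) = begin
    wsum xs (λ K → h x K + ∑ (map (λ (y , ys) → y , x ∷ ys) (picks K)) (λ (y , K′) → h y K′)) + q * wsum xs pk
      ≡⟨ cong (_+ q * wsum xs pk) (wsum-cong xs (λ K → cong (h x K +_) (∑-map _ _ (picks K)))) ⟩
    wsum xs (λ K → h x K + ∑ (picks K) (λ (y , K′) → h y (x ∷ K′))) + q * wsum xs pk
      ≡⟨ cong₂ (λ a b → a + q * b) (trans (wsum-+ _ _ xs) (cong (wsum xs (h x) +_) (wsum-picks (λ y → h y ∘ (x ∷_)) xs)))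
               (wsum-picks h xs) ⟩
    wsum xs (h x) + ∑ (picks xs) (λ (u , R) → wsum R (h u ∘ (x ∷_))) + q * ∑ (picks xs) (λ (u , R) → wsum R (h u))
      ≡⟨ +-assoc (wsum xs (h x)) _ _ ⟩
    wsum xs (h x) + (∑ (picks xs) (λ (u , R) → wsum R (h u ∘ (x ∷_))) + q * ∑ (picks xs) (λ (u , R) → wsum R (h u)))
      ≡⟨ cong (wsum xs (h x) +_) (sym (trans (∑-map _ _ (picks xs)) (trans (∑-+ _ _ (picks xs))
           (cong (∑ (picks xs) (λ (u , R) → wsum R (h u ∘ (x ∷_))) +_) (∑-*ˡ q _ (picks xs)))))) ⟩
    ∑ (picks (x ∷ xs)) (λ (u , R) → wsum R (h u)) ∎
    where
    open ≡-Reasoning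
    pk : List A → ℕ
    pk K = ∑ (picks K) (λ (y , K′) → h y K′)

  -- The first-moment method: if the totals compare strictly, so does one of the two branches at
  -- each entry.
  wsum-extract : ∀ f g xs → wsum xs f < wsum xs g → ∃ λ K → K ⊆ xs × f K < g K
  wsum-extract f g []       f<g = [] , [] , f<g
  wsum-extract f g (x ∷ xs) f<g with wsum xs (f ∘ (x ∷_)) <? wsum xs (g ∘ (x ∷_)) | wsum xs f <? wsum xs g
  ... | yes lt | _ = let K , K⊆ , p = wsum-extract _ _ xs lt in x ∷ K , refl ∷ K⊆ , p
  ... | no _ | yes lt = let K , K⊆ , p = wsum-extract f g xs lt in K , x ∷ʳ K⊆ , p
  ... | no ≮ | no ≮′ = contradiction f<g (≤⇒≯ (+-mono-≤ (≮⇒≥ ≮) (*-monoʳ-≤ q (≮⇒≥ ≮′))))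

-- Exponential inequalities and the trade-off at one vertex

^-distribʳ-* : ∀ n x y → (x * y) ^ n ≡ x ^ n * y ^ n
^-distribʳ-* zero    x y = refl
^-distribʳ-* (suc n) x y = trans (cong (x * y *_) (^-distribʳ-* n x y)) (lem x y (x ^ n) (y ^ n))
  where
  lem : ∀ a b c d → a * b * (c * d) ≡ a * c * (b * d)
  lem = solve-∀

-- This is y/q ≤ (1 + 1/q)^y, multiplied by q^(y+1).
bernoulli : ∀ q y → y * q ^ y ≤ q * suc q ^ y
bernoulli q zero    = z≤n
bernoulli q (suc y) = begin
  suc y * (q * q ^ y)                   ≡⟨ lem₁ y q (q ^ y) ⟩
  q * (y * q ^ y) + q * q ^ y           ≤⟨ +-mono-≤ (*-monoʳ-≤ q (bernoulli q y)) (*-monoʳ-≤ q (^-monoˡ-≤ y (n≤1+n q))) ⟩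
  q * (q * suc q ^ y) + q * suc q ^ y   ≡⟨ lem₂ q (suc q ^ y) ⟩
  q * (suc q * suc q ^ y)               ∎
  where
  open ≤-Reasoning
  lem₁ : ∀ y q a → suc y * (q * a) ≡ q * (y * a) + q * a
  lem₁ = solve-∀
  lem₂ : ∀ q a → q * (q * a) + q * a ≡ q * (suc q * a)
  lem₂ = solve-∀

-- This is 1 - j/(q+1) ≤ (1 - 1/(q+1))^j, multiplied by (q+1)^(j+1) and with the subtracted term
-- moved across.
bernoulli⁻ : ∀ q j → suc q * suc q ^ j ≤ suc q * q ^ j + j * suc q ^ j
bernoulli⁻ q zero    = ≤-reflexive (sym (+-identityʳ _))
bernoulli⁻ q (suc j) = begin
  b * (b * b ^ j)                       ≤⟨ *-monoʳ-≤ b (bernoulli⁻ q j) ⟩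
  b * (b * q ^ j + j * b ^ j)           ≡⟨ lem₁ q j (q ^ j) (b ^ j) ⟩
  b * (q * q ^ j) + b * q ^ j + j * (b * b ^ j)
    ≤⟨ +-monoˡ-≤ _ (+-monoʳ-≤ (b * (q * q ^ j)) (*-monoʳ-≤ b (^-monoˡ-≤ j (n≤1+n q)))) ⟩
  b * (q * q ^ j) + b * b ^ j + j * (b * b ^ j) ≡⟨ +-assoc (b * (q * q ^ j)) _ _ ⟩
  b * (q * q ^ j) + suc j * (b * b ^ j) ∎
  where
  open ≤-Reasoning
  b = suc q
  lem₁ : ∀ q j x y → suc q * (suc q * x + j * y) ≡ suc q * (q * x) + suc q * x + j * (suc q * y)
  lem₁ = solve-∀

-- (1 + 1/q)^(q+1) ≤ 4, restricted to even q + 1 so that Bernoulli's inequality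
-- can be applied at the exponent (q+1)/2 and squared.
[1+1/q]^[q+1]≤4 : ∀ q k → suc q ≡ 2 * k → suc q ^ suc q ≤ 4 * q ^ suc q
[1+1/q]^[q+1]≤4 q k@(suc _) b≡2k = begin
  suc q ^ suc q             ≡⟨ square (suc q) ⟩
  suc q ^ k * suc q ^ k     ≤⟨ *-mono-≤ half half ⟩
  2 * q ^ k * (2 * q ^ k)   ≡⟨ lem (q ^ k) ⟩
  4 * (q ^ k * q ^ k)       ≡⟨ cong (4 *_) (sym (square q)) ⟩
  4 * q ^ suc q             ∎
  where
  open ≤-Reasoning
  lem : ∀ x → 2 * x * (2 * x) ≡ 4 * (x * x)
  lem = solve-∀
  square : ∀ a → a ^ suc q ≡ a ^ k * a ^ k
  square a = trans (cong (a ^_) (trans b≡2k (cong (k +_) (+-identityʳ k)))) (^-distribˡ-+-* a k k)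
  lem₂ : ∀ k x → 2 * k * x ≡ k * x + k * x
  lem₂ = solve-∀
  lem₃ : ∀ k x → 2 * k * x ≡ k * (2 * x)
  lem₃ = solve-∀
  half : suc q ^ k ≤ 2 * q ^ k
  half = *-cancelˡ-≤ k (+-cancelʳ-≤ (k * suc q ^ k) _ _ (begin
    k * suc q ^ k + k * suc q ^ k   ≡⟨ sym (lem₂ k (suc q ^ k)) ⟩
    2 * k * suc q ^ k               ≡⟨ cong (_* suc q ^ k) (sym b≡2k) ⟩
    suc q * suc q ^ k               ≤⟨ bernoulli⁻ q k ⟩
    suc q * q ^ k + k * suc q ^ k   ≡⟨ cong (λ z → z * q ^ k + k * suc q ^ k) b≡2k ⟩
    2 * k * q ^ k + k * suc q ^ k   ≡⟨ cong (_+ k * suc q ^ k) (lem₃ k (q ^ k)) ⟩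
    k * (2 * q ^ k) + k * suc q ^ k ∎))

module _ {q k} .{{_ : NonZero q}} (b≡2k : suc q ≡ 2 * k) where

  private
    b = suc q

  -- Since y ≤ q (1+1/q)^y, the left side is at most q (1+1/q)^(m+y) q^m.
  tail-bound : ∀ c m y → m + y ≡ b * suc c → y * b ^ m ≤ q * 4 ^ suc c * q ^ m
  tail-bound c m y m+y≡ = *-cancelˡ-≤ (q ^ y) {{m^n≢0 q y}} (begin
    q ^ y * (y * b ^ m)             ≡⟨ lem₁ (q ^ y) y (b ^ m) ⟩
    y * q ^ y * b ^ m               ≤⟨ *-monoˡ-≤ (b ^ m) (bernoulli q y) ⟩
    q * b ^ y * b ^ m               ≡⟨ trans (*-assoc q _ _) (cong (q *_) (trans (*-comm (b ^ y) _) (sym (^-distribˡ-+-* b m y)))) ⟩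
    q * b ^ (m + y)                 ≡⟨ cong (λ z → q * b ^ z) m+y≡ ⟩
    q * b ^ (b * suc c)             ≡⟨ cong (q *_) (sym (^-*-assoc b b (suc c))) ⟩
    q * (b ^ b) ^ suc c             ≤⟨ *-monoʳ-≤ q (^-monoˡ-≤ (suc c) ([1+1/q]^[q+1]≤4 q k b≡2k)) ⟩
    q * (4 * q ^ b) ^ suc c         ≡⟨ cong (q *_) (^-distribʳ-* (suc c) 4 (q ^ b)) ⟩
    q * (4 ^ suc c * (q ^ b) ^ suc c) ≡⟨ cong (λ z → q * (4 ^ suc c * z)) (trans (^-*-assoc q b (suc c)) (cong (q ^_) (sym m+y≡))) ⟩
    q * (4 ^ suc c * q ^ (m + y))   ≡⟨ cong (λ z → q * (4 ^ suc c * z)) (^-distribˡ-+-* q m y) ⟩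
    q * (4 ^ suc c * (q ^ m * q ^ y)) ≡⟨ lem₂ q (4 ^ suc c) (q ^ m) (q ^ y) ⟩
    q ^ y * (q * 4 ^ suc c * q ^ m) ∎)
    where
    open ≤-Reasoning
    lem₁ : ∀ a y z → a * (y * z) ≡ y * a * z
    lem₁ = solve-∀
    lem₂ : ∀ a b c d → a * (b * (c * d)) ≡ d * (a * b * c)
    lem₂ = solve-∀

  -- Z and M / Z stand for the partition function and the mean size of a
  -- random independent set in an m-vertex graph with s ordered edges.
  local-bound : ∀ {c D s m Z M} → s ≤ b * b → q * 4 ^ suc c + c ≤ D → Z ≤ b ^ m →
    b * (m * Z) ≤ b * (b * M) + s * Z → c * (q ^ m + q * Z) ≤ D * q ^ m + q * M
  local-bound {c} {D} {s} {m} {Z} {M} s≤ D≥ Z≤ occ = cases (≤-total (b * suc c) m)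
    where
    open ≤-Reasoning
    -- As s ≤ b², the edges cost the mean size at most 1: M/Z ≥ m/b - 1.
    occ′ : m * Z ≤ b * M + b * Z
    occ′ = *-cancelˡ-≤ b (begin
      b * (m * Z)               ≤⟨ occ ⟩
      b * (b * M) + s * Z       ≤⟨ +-monoʳ-≤ (b * (b * M)) (*-monoˡ-≤ Z s≤) ⟩
      b * (b * M) + b * b * Z   ≡⟨ lem b M Z ⟩
      b * (b * M + b * Z)       ∎)
      where
      lem : ∀ b m z → b * (b * m) + b * b * z ≡ b * (b * m + b * z)
      lem = solve-∀
    cases : _ → _
    -- Here m/b - 1 ≥ c, so the neighbours alone pay for every case in which v is omitted.
    cases (inj₁ large) = begin
      c * (q ^ m + q * Z)       ≡⟨ lem₁ c (q ^ m) q Z ⟩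
      c * q ^ m + q * (c * Z)   ≤⟨ +-mono-≤ (*-monoˡ-≤ (q ^ m) (≤-trans (m≤n+m c _) D≥)) (*-monoʳ-≤ q cZ≤M) ⟩
      D * q ^ m + q * M         ∎
      where
      lem₁ : ∀ c x q z → c * (x + q * z) ≡ c * x + q * (c * z)
      lem₁ = solve-∀
      lem₂ : ∀ b c z → b * (c * z + z) ≡ b * suc c * z
      lem₂ = solve-∀
      cZ≤M : c * Z ≤ M
      cZ≤M = +-cancelʳ-≤ Z _ _ (*-cancelˡ-≤ b (begin
        b * (c * Z + Z)   ≡⟨ lem₂ b c Z ⟩
        b * suc c * Z     ≤⟨ *-monoˡ-≤ Z large ⟩
        m * Z             ≤⟨ occ′ ⟩
        b * M + b * Z     ≡⟨ sym (*-distribˡ-+ b M Z) ⟩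
        b * (M + Z)       ∎))
    -- The neighbours fall short of c by at most y/b, with y = b(c+1) - m; `tail-bound` charges the
    -- missing y Z to the term q^m of v.
    cases (inj₂ small) = *-cancelˡ-≤ b (begin
      b * (c * (q ^ m + q * Z))                 ≡⟨ lem₁ b c (q ^ m) q Z ⟩
      b * (c * q ^ m) + q * (b * c * Z)         ≤⟨ +-monoʳ-≤ (b * (c * q ^ m)) (*-monoʳ-≤ q bcZ≤) ⟩
      b * (c * q ^ m) + q * (b * M + y * Z)     ≤⟨ +-monoʳ-≤ (b * (c * q ^ m)) (*-monoʳ-≤ q (+-monoʳ-≤ (b * M) yZ≤)) ⟩
      b * (c * q ^ m) + q * (b * M + q * 4 ^ suc c * q ^ m)
                                                ≡⟨ lem₂ b c (q ^ m) q M (q * 4 ^ suc c) ⟩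
      q * (q * 4 ^ suc c * q ^ m) + b * (c * q ^ m + q * M)
                                                ≤⟨ +-monoˡ-≤ _ (*-monoˡ-≤ (q * 4 ^ suc c * q ^ m) (n≤1+n q)) ⟩
      b * (q * 4 ^ suc c * q ^ m) + b * (c * q ^ m + q * M)
                                                ≡⟨ lem₃ b c (q ^ m) q M (q * 4 ^ suc c) ⟩
      b * ((q * 4 ^ suc c + c) * q ^ m + q * M) ≤⟨ *-monoʳ-≤ b (+-monoˡ-≤ (q * M) (*-monoˡ-≤ (q ^ m) D≥)) ⟩
      b * (D * q ^ m + q * M)                   ∎)
      where
      y = b * suc c ∸ m
      m+y≡ : m + y ≡ b * suc c
      m+y≡ = m+[n∸m]≡n small
      yZ≤ : y * Z ≤ q * 4 ^ suc c * q ^ m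
      yZ≤ = ≤-trans (*-monoʳ-≤ y Z≤) (tail-bound c m y m+y≡)
      bcZ≤ : b * c * Z ≤ b * M + y * Z
      bcZ≤ = +-cancelʳ-≤ (b * Z) _ _ (begin
        b * c * Z + b * Z       ≡⟨ lem b c Z ⟩
        b * suc c * Z           ≡⟨ cong (_* Z) (sym m+y≡) ⟩
        (m + y) * Z             ≡⟨ *-distribʳ-+ Z m y ⟩
        m * Z + y * Z           ≤⟨ +-monoˡ-≤ (y * Z) occ′ ⟩
        b * M + b * Z + y * Z   ≡⟨ lem′ (b * M) (b * Z) (y * Z) ⟩
        b * M + y * Z + b * Z   ∎)
        where
        lem : ∀ b c z → b * c * z + b * z ≡ b * suc c * z
        lem = solve-∀
        lem′ : ∀ x y z → x + y + z ≡ x + z + y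
        lem′ = solve-∀
      lem₁ : ∀ b c x q z → b * (c * (x + q * z)) ≡ b * (c * x) + q * (b * c * z)
      lem₁ = solve-∀
      lem₂ : ∀ b c x q M f → b * (c * x) + q * (b * M + f * x) ≡ q * (f * x) + b * (c * x + q * M)
      lem₂ = solve-∀
      lem₃ : ∀ b c x q M f → b * (f * x) + b * (c * x + q * M) ≡ b * ((f + c) * x + q * M)
      lem₃ = solve-∀

-- The hard-core model on a graph

module Graph {A : Set} (adj : A → A → Bool)
             (adj-sym : ∀ x y → adj x y ≡ adj y x) (adj-irrefl : ∀ x → adj x x ≡ false) where

  e : A → A → ℕ
  e x y = 𝟙 (adj x y)

  -- Constraints are 0/1-valued numbers, here and in `ind`, so that they multiply into the weights
  -- and factor over concatenations.
  avoid : A → List A → ℕ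
  avoid u []      = 1
  avoid u (x ∷ K) = 𝟙 (not (adj u x)) * avoid u K

  ind : List A → ℕ
  ind []      = 1
  ind (u ∷ K) = avoid u K * ind K

  avoid≤1 : ∀ u K → avoid u K ≤ 1
  avoid≤1 u []      = ≤-refl
  avoid≤1 u (x ∷ K) with adj u x
  ... | true  = z≤n
  ... | false = ≤-trans (≤-reflexive (+-identityʳ _)) (avoid≤1 u K)

  avoid-idem : ∀ u K → avoid u K * avoid u K ≡ avoid u K
  avoid-idem u []      = refl
  avoid-idem u (x ∷ K) with adj u x
  ... | true  = refl
  ... | false = trans (cong₂ _*_ (+-identityʳ (avoid u K)) (+-identityʳ (avoid u K)))
                      (trans (avoid-idem u K) (sym (+-identityʳ _)))

  avoid-self : ∀ u K → avoid u (u ∷ K) ≡ avoid u K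
  avoid-self u K rewrite adj-irrefl u = +-identityʳ _

  avoid-++ : ∀ u K L → avoid u (K ++ L) ≡ avoid u K * avoid u L
  avoid-++ u []      L = sym (+-identityʳ _)
  avoid-++ u (x ∷ K) L = trans (cong (𝟙 (not (adj u x)) *_) (avoid-++ u K L)) (sym (*-assoc (𝟙 (not (adj u x))) _ _))

  -- The union bound before taking means: either no neighbour of u is in K or at least one is
  -- counted.
  1≤avoid+degree : ∀ u K → 1 ≤ avoid u K + ∑ K (e u)
  1≤avoid+degree u []      = ≤-refl
  1≤avoid+degree u (x ∷ K) with adj u x
  ... | true  = s≤s z≤n
  ... | false = ≤-trans (1≤avoid+degree u K) (+-monoˡ-≤ (∑ K (e u)) (≤-reflexive (sym (+-identityʳ _))))

  avoid-↭ : ∀ u {K L} → K ↭ L → avoid u K ≡ avoid u L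
  avoid-↭ u Perm.refl = refl
  avoid-↭ u (prep x p) = cong (𝟙 (not (adj u x)) *_) (avoid-↭ u p)
  avoid-↭ u (Perm.swap x y p) = trans (cong (λ z → a * (b * z)) (avoid-↭ u p)) (lem a b _)
    where
    a = 𝟙 (not (adj u x))
    b = 𝟙 (not (adj u y))
    lem : ∀ a b c → a * (b * c) ≡ b * (a * c)
    lem = solve-∀
  avoid-↭ u (Perm.trans p p′) = trans (avoid-↭ u p) (avoid-↭ u p′)

  ind-↭ : ∀ {K L} → K ↭ L → ind K ≡ ind L
  ind-↭ Perm.refl = refl
  ind-↭ (prep x p) = cong₂ _*_ (avoid-↭ x p) (ind-↭ p)
  ind-↭ (Perm.swap {K} {L} x y p) = trans
    (cong₂ (λ a b → 𝟙 (not a) * avoid x K * b) (adj-sym x y) (cong (avoid y K *_) (ind-↭ p)))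
    (trans (cong₂ (λ a b → 𝟙 (not (adj y x)) * a * (b * ind L)) (avoid-↭ x p) (avoid-↭ y p))
           (lem (𝟙 (not (adj y x))) (avoid x L) (avoid y L) (ind L)))
    where
    lem : ∀ a b c d → a * b * (c * d) ≡ a * c * (b * d)
    lem = solve-∀
  ind-↭ (Perm.trans p p′) = trans (ind-↭ p) (ind-↭ p′)

  cross : List A → List A → ℕ
  cross J []      = 1
  cross J (x ∷ K) = avoid x J * cross J K

  ind-++ : ∀ J K → ind (J ++ K) ≡ ind J * (cross J K * ind K)
  ind-++ J K = trans (ind-↭ (++-comm J K)) (go K)
    where
    lem : ∀ a b c d f → a * b * (c * (d * f)) ≡ c * (b * d * (a * f))
    lem = solve-∀
    go : ∀ K → ind (K ++ J) ≡ ind J * (cross J K * ind K)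
    go []      = sym (*-identityʳ _)
    go (x ∷ K) = trans (cong₂ _*_ (avoid-++ x K J) (go K)) (lem (avoid x K) (avoid x J) (ind J) (cross J K) (ind K))

  ∑-picks-ind : ∀ (φ : A → ℕ) K → ∑ (picks K) (λ (x , K′) → φ x * ind (x ∷ K′)) ≡ ∑ K φ * ind K
  ∑-picks-ind φ K = begin
    ∑ (picks K) (λ (x , K′) → φ x * ind (x ∷ K′)) ≡⟨ ∑-congᴬ (All.map (λ {(x , _)} p → cong (φ x *_) (sym (ind-↭ p))) (picks-↭ K)) ⟩
    ∑ (picks K) (λ (x , _) → φ x * ind K)         ≡⟨ ∑-*ʳ (ind K) (φ ∘ proj₁) (picks K) ⟩
    ∑ (picks K) (φ ∘ proj₁) * ind K               ≡⟨ cong (_* ind K) (∑-picks φ K) ⟩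
    ∑ K φ * ind K                                 ∎
    where open ≡-Reasoning

  ∑-picks-ind₁ : ∀ K → ∑ (picks K) (λ (x , K′) → ind (x ∷ K′)) ≡ length K * ind K
  ∑-picks-ind₁ K = begin
    ∑ (picks K) (λ (x , K′) → ind (x ∷ K′))     ≡⟨ ∑-cong (picks K) (λ (x , K′) → sym (+-identityʳ (ind (x ∷ K′)))) ⟩
    ∑ (picks K) (λ (x , K′) → 1 * ind (x ∷ K′)) ≡⟨ ∑-picks-ind (const 1) K ⟩
    ∑ K (const 1) * ind K                       ≡⟨ cong (_* ind K) (trans (∑-const 1 K) (*-identityʳ (length K))) ⟩
    length K * ind K                            ∎
    where open ≡-Reasoning

  -- A maximal independent set dominates the graph.
  greedy : ∀ xs → ∃ λ I → I ⊆ xs × ind I ≡ 1 × length xs ≤ ∑ I (λ y → suc (∑ xs (e y)))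
  greedy [] = [] , [] , refl , z≤n
  greedy (x ∷ xs) with greedy xs
  ... | I , I⊆ , indI , dom with avoid x I ≟ 1
  ... | yes free = x ∷ I , refl ∷ I⊆ , cong₂ _*_ free indI ,
        +-mono-≤ (s≤s (z≤n {∑ (x ∷ xs) (e x)})) (≤-trans dom (∑-mono′ I (λ y → s≤s (m≤n+m _ _))))
  ... | no ¬free = I , x ∷ʳ I⊆ , indI , (begin
        suc (length xs)                                        ≤⟨ +-mono-≤ nbr dom ⟩
        ∑ I (λ y → e y x) + ∑ I (λ y → suc (∑ xs (e y)))       ≡⟨ sym (∑-+ _ _ I) ⟩
        ∑ I (λ y → e y x + suc (∑ xs (e y)))                   ≡⟨ ∑-cong I (λ y → +-suc (e y x) _) ⟩
        ∑ I (λ y → suc (∑ (x ∷ xs) (e y)))                     ∎)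
    where
    open ≤-Reasoning
    nbr : 1 ≤ ∑ I (λ y → e y x)
    nbr = begin
      1                       ≤⟨ 1≤avoid+degree x I ⟩
      avoid x I + ∑ I (e x)   ≡⟨ cong (_+ ∑ I (e x)) (n<1⇒n≡0 (≤∧≢⇒< (avoid≤1 x I) ¬free)) ⟩
      ∑ I (e x)               ≡⟨ ∑-cong I (λ y → cong 𝟙 (adj-sym x y)) ⟩
      ∑ I (λ y → e y x)       ∎

  split : ∀ v R → ∃₂ λ Out Nv → R ↭ Out ++ Nv × All (λ x → adj v x ≡ false) Out × All (λ x → adj v x ≡ true) Nv
  split v [] = [] , [] , Perm.refl , [] , []
  split v (x ∷ R) with split v R | adj v x in eq
  ... | Out , Nv , p , o , n | true  = Out , x ∷ Nv , ↭-trans (prep x p) (↭-sym (shift x Out Nv)) , o , eq ∷ n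
  ... | Out , Nv , p , o , n | false = x ∷ Out , Nv , prep x p , eq ∷ o , n

  module _ (q : ℕ) where

    open WeightedSum {A} q

    wsum-∑ : ∀ {B : Set} (h : List A → B → ℕ) ys xs →
             wsum xs (λ K → ∑ ys (h K)) ≡ ∑ ys (λ y → wsum xs (λ K → h K y))
    wsum-∑ h []       xs = trans (wsum-const 0 xs) (*-zeroʳ (suc q ^ length xs))
    wsum-∑ h (y ∷ ys) xs = trans (wsum-+ (λ K → h K y) (λ K → ∑ ys (h K)) xs)
                                 (cong (wsum xs (λ K → h K y) +_) (wsum-∑ h ys xs))

    wsum-vanish : ∀ {P : A → Set} {f xs} → All P xs → (∀ {x} K → P x → f (x ∷ K) ≡ 0) →
                  wsum xs f ≡ q ^ length xs * f []
    wsum-vanish {f = f} [] van = sym (+-identityʳ (f []))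
    wsum-vanish {f = f} {x ∷ xs} (p ∷ ps) van = begin
      wsum xs (f ∘ (x ∷_)) + q * wsum xs f
        ≡⟨ cong₂ (λ a b → a + q * b)
             (trans (wsum-cong xs (λ K → van K p)) (trans (wsum-const 0 xs) (*-zeroʳ (suc q ^ length xs))))
             (wsum-vanish ps van) ⟩
      q * (q ^ length xs * f []) ≡⟨ sym (*-assoc q _ _) ⟩
      q * q ^ length xs * f []   ∎
      where open ≡-Reasoning

    -- F consists of the vertices of N without a neighbour in J.
    restrict : ∀ J N → ∃₂ λ F j → F ⊆ N × length N ≡ j + length F ×
               (∀ g → wsum N (λ K → cross J K * g K) ≡ q ^ j * wsum F g)
    restrict J [] = [] , 0 , [] , refl , λ g → refl
    restrict J (x ∷ N) with restrict J N | avoid x J ≟ 1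
    ... | F , j , F⊆ , len , eq | yes free = x ∷ F , j , refl ∷ F⊆ , trans (cong suc len) (sym (+-suc j _)) , λ g → begin
      wsum N (λ K → avoid x J * cross J K * g (x ∷ K)) + q * wsum N (λ K → cross J K * g K)
        ≡⟨ cong₂ (λ a b → a + q * b)
             (trans (wsum-cong N (λ K → trans (cong (λ z → z * cross J K * g (x ∷ K)) free) (cong (_* g (x ∷ K)) (+-identityʳ (cross J K))))) (eq (g ∘ (x ∷_))))
             (eq g) ⟩
      q ^ j * wsum F (g ∘ (x ∷_)) + q * (q ^ j * wsum F g)
        ≡⟨ lem (q ^ j) (wsum F (g ∘ (x ∷_))) q (wsum F g) ⟩
      q ^ j * (wsum F (g ∘ (x ∷_)) + q * wsum F g) ∎
      where
      open ≡-Reasoning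
      lem : ∀ a b c d → a * b + c * (a * d) ≡ a * (b + c * d)
      lem = solve-∀
    -- A vertex with a neighbour in `J` can only be left out; this gives one factor q, recorded by
    -- `j`.
    ... | F , j , F⊆ , len , eq | no ¬free = F , suc j , x ∷ʳ F⊆ , cong suc len , λ g → begin
      wsum N (λ K → avoid x J * cross J K * g (x ∷ K)) + q * wsum N (λ K → cross J K * g K)
        ≡⟨ cong₂ (λ a b → a + q * b)
             (trans (wsum-cong N (λ K → cong (λ z → z * cross J K * g (x ∷ K)) (n<1⇒n≡0 (≤∧≢⇒< (avoid≤1 x J) ¬free))))
                    (trans (wsum-const 0 N) (*-zeroʳ (suc q ^ length N))))
             (eq g) ⟩
      q * (q ^ j * wsum F g)  ≡⟨ sym (*-assoc q _ _) ⟩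
      q * q ^ j * wsum F g    ∎
      where open ≡-Reasoning

    ind≤1 : ∀ K → ind K ≤ 1
    ind≤1 []      = ≤-refl
    ind≤1 (u ∷ K) = *-mono-≤ (avoid≤1 u K) (ind≤1 K)

    -- If K were not independent both sides would be 0, so a strict inequality certifies
    -- independence.
    <⇒ind≡1 : ∀ K {a b} → a * ind K < b * ind K → ind K ≡ 1
    <⇒ind≡1 K {a} {b} lt with ind K | ind≤1 K
    ... | zero        | _       = contradiction (subst₂ _<_ (*-zeroʳ a) (*-zeroʳ b) lt) n≮0
    ... | suc zero    | _       = refl
    ... | suc (suc _) | s≤s ()

    -- P(u ∈ K) = λ/(1+λ) · P(no neighbour of u is in K), with λ = 1/q.
    occupation : ∀ {F u R} → F ↭ u ∷ R →
      suc q * wsum R (λ K → ind (u ∷ K)) ≡ wsum F (λ K → avoid u K * ind K)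
    occupation {F} {u} {R} p = sym (begin
      wsum F (λ K → avoid u K * ind K)
        ≡⟨ wsum-↭ (λ p′ → cong₂ _*_ (avoid-↭ u p′) (ind-↭ p′)) p ⟩
      wsum R (λ K → avoid u (u ∷ K) * (avoid u K * ind K)) + q * wsum R (λ K → avoid u K * ind K)
        ≡⟨ cong (_+ q * wsum R (λ K → ind (u ∷ K))) (wsum-cong R (λ K →
             trans (cong (_* (avoid u K * ind K)) (avoid-self u K))
             (trans (sym (*-assoc (avoid u K) (avoid u K) (ind K))) (cong (_* ind K) (avoid-idem u K))))) ⟩
      suc q * wsum R (λ K → ind (u ∷ K)) ∎)
      where open ≡-Reasoning

    Z : List A → ℕ
    Z F = wsum F ind

    M : List A → ℕ
    M F = wsum F (λ K → length K * ind K)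

    -- Linearity of expectation: the size of K is the sum of its membership indicators.
    ∑-occupation : ∀ F → ∑ (picks F) (λ (u , R) → wsum R (λ K → ind (u ∷ K))) ≡ M F
    ∑-occupation F = trans (sym (wsum-picks (λ u K → ind (u ∷ K)) F)) (wsum-cong F ∑-picks-ind₁)

    -- With b = q + 1: P(u ∈ K) is 1/b times the probability that K has no neighbour of u, which by
    -- the union bound is at least 1 - ∑ P(x ∈ K) over the neighbours x, and each P(x ∈ K) ≤ 1/b.
    -- Summing over u gives m/b ≤ M/Z + s/b² for s ordered edges; the statement is multiplied by b²
    -- Z.
    mean-size : ∀ F → suc q * (length F * Z F) ≤ suc q * (suc q * M F) + ∑ F (λ u → ∑ F (e u)) * Z F
    mean-size F = begin
      b * (length F * Z F)                        ≡⟨ cong (b *_) (sym (trans (∑-picks (const (Z F)) F) (∑-const (Z F) F))) ⟩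
      b * ∑ (picks F) (const (Z F))               ≡⟨ sym (∑-*ˡ b _ (picks F)) ⟩
      ∑ (picks F) (λ _ → b * Z F)                 ≤⟨ ∑-mono (All.map (λ {(u , R)} → vertex u R) (picks-↭ F)) ⟩
      ∑ (picks F) (λ uR → b * (b * P uR) + ∑ F (e (proj₁ uR)) * Z F)
                                                  ≡⟨ ∑-+ (λ uR → b * (b * P uR)) _ (picks F) ⟩
      ∑ (picks F) (λ uR → b * (b * P uR)) + ∑ (picks F) (λ uR → ∑ F (e (proj₁ uR)) * Z F)
                                                  ≡⟨ cong₂ _+_ (trans (∑-*ˡ b (λ uR → b * P uR) (picks F)) (cong (b *_) (trans (∑-*ˡ b P (picks F)) (cong (b *_) (∑-occupation F)))))
                                                               (trans (∑-*ʳ (Z F) (λ uR → ∑ F (e (proj₁ uR))) (picks F)) (cong (_* Z F) (∑-picks (λ u → ∑ F (e u)) F))) ⟩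
      b * (b * M F) + ∑ F (λ u → ∑ F (e u)) * Z F ∎
      where
      open ≤-Reasoning
      b = suc q
      P : A × List A → ℕ
      P (u , R) = wsum R (λ K → ind (u ∷ K))
      P≤ : ∀ {u R} → F ↭ u ∷ R → b * P (u , R) ≤ Z F
      P≤ {u} {R} p = begin
        b * P (u , R)                      ≡⟨ occupation p ⟩
        wsum F (λ K → avoid u K * ind K)   ≤⟨ wsum-mono′ F (λ K → ≤-trans (*-monoˡ-≤ (ind K) (avoid≤1 u K)) (≤-reflexive (+-identityʳ _))) ⟩
        Z F                                ∎
      union : ∀ u → Z F ≤ wsum F (λ K → avoid u K * ind K) + ∑ (picks F) (λ xR → e u (proj₁ xR) * P xR)
      union u = begin
        Z F  ≤⟨ wsum-mono′ F (λ K → begin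
                  ind K                                       ≡⟨ sym (+-identityʳ _) ⟩
                  1 * ind K                                   ≤⟨ *-monoˡ-≤ (ind K) (1≤avoid+degree u K) ⟩
                  (avoid u K + ∑ K (e u)) * ind K             ≡⟨ *-distribʳ-+ (ind K) (avoid u K) _ ⟩
                  avoid u K * ind K + ∑ K (e u) * ind K       ≡⟨ cong (avoid u K * ind K +_) (sym (∑-picks-ind (e u) K)) ⟩
                  avoid u K * ind K + ∑ (picks K) (λ (x , K′) → e u x * ind (x ∷ K′)) ∎) ⟩
        wsum F (λ K → avoid u K * ind K + ∑ (picks K) (λ (x , K′) → e u x * ind (x ∷ K′)))
             ≡⟨ wsum-+ _ _ F ⟩
        wsum F (λ K → avoid u K * ind K) + wsum F (λ K → ∑ (picks K) (λ (x , K′) → e u x * ind (x ∷ K′)))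
             ≡⟨ cong (wsum F (λ K → avoid u K * ind K) +_) (trans (wsum-picks (λ x K′ → e u x * ind (x ∷ K′)) F)
                  (∑-cong (picks F) (λ (x , R) → wsum-*ˡ (e u x) (λ K → ind (x ∷ K)) R))) ⟩
        wsum F (λ K → avoid u K * ind K) + ∑ (picks F) (λ xR → e u (proj₁ xR) * P xR) ∎
      vertex : ∀ u R → F ↭ u ∷ R → b * Z F ≤ b * (b * P (u , R)) + ∑ F (e u) * Z F
      vertex u R p = begin
        b * Z F
          ≤⟨ *-monoʳ-≤ b (union u) ⟩
        b * (wsum F (λ K → avoid u K * ind K) + ∑ (picks F) (λ xR → e u (proj₁ xR) * P xR))
          ≡⟨ *-distribˡ-+ b (wsum F (λ K → avoid u K * ind K)) _ ⟩
        b * wsum F (λ K → avoid u K * ind K) + b * ∑ (picks F) (λ xR → e u (proj₁ xR) * P xR)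
          ≡⟨ cong₂ _+_ (cong (b *_) (sym (occupation p))) (sym (∑-*ˡ b (λ xR → e u (proj₁ xR) * P xR) (picks F))) ⟩
        b * (b * P (u , R)) + ∑ (picks F) (λ xR → b * (e u (proj₁ xR) * P xR))
          ≤⟨ +-monoʳ-≤ (b * (b * P (u , R))) (∑-mono (All.map (λ {(x , R′)} p′ →
               ≤-trans (≤-reflexive (lem b (e u x) (P (x , R′)))) (*-monoʳ-≤ (e u x) (P≤ p′))) (picks-↭ F))) ⟩
        b * (b * P (u , R)) + ∑ (picks F) (λ xR → e u (proj₁ xR) * Z F)
          ≡⟨ cong (b * (b * P (u , R)) +_) (trans (∑-*ʳ (Z F) (λ xR → e u (proj₁ xR)) (picks F)) (cong (_* Z F) (∑-picks (e u) F))) ⟩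
        b * (b * P (u , R)) + ∑ F (e u) * Z F ∎
        where
        lem : ∀ a b c → a * (b * c) ≡ b * (a * c)
        lem = solve-∀

    Z≤ : ∀ F → Z F ≤ suc q ^ length F
    Z≤ F = ≤-trans (wsum-mono′ F ind≤1) (≤-reflexive (trans (wsum-const 1 F) (*-identityʳ _)))

    module _ .{{_ : NonZero q}} {k c D s : ℕ} (b≡2k : suc q ≡ 2 * k) (s≤ : s ≤ suc q * suc q)
             (D≥ : q * 4 ^ suc c + c ≤ D) where

      -- Conditioning on the part J of the random independent set outside the
      -- closed neighbourhood of v.
      vertex-bound : ∀ v R → ∑ R (λ u → ∑ R (λ u′ → e v u * e v u′ * e u u′)) ≤ s →
        c * (wsum R (λ K → ind (v ∷ K)) + q * Z R)
          ≤ D * wsum R (λ K → ind (v ∷ K)) + q * wsum R (λ K → ∑ K (e v) * ind K)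
      vertex-bound v R tri with split v R
      ... | Out , Nv , R↭ , o , n = begin
        c * (wsum R (λ K → ind (v ∷ K)) + q * Z R)
          ≡⟨ cong (c *_) (cong₂ (λ a b → a + q * b) A≡ (byParts ind ind-↭)) ⟩
        c * (wsum Out aJ + q * wsum Out zJ)
          ≡⟨ cong (c *_) (sym (trans (wsum-+ aJ (λ J → q * zJ J) Out) (cong (wsum Out aJ +_) (wsum-*ˡ q zJ Out)))) ⟩
        c * wsum Out (λ J → aJ J + q * zJ J)
          ≡⟨ sym (wsum-*ˡ c (λ J → aJ J + q * zJ J) Out) ⟩
        wsum Out (λ J → c * (aJ J + q * zJ J))
          ≤⟨ wsum-mono′ Out conditional ⟩
        wsum Out (λ J → D * aJ J + q * lJ J)
          ≡⟨ trans (wsum-+ (λ J → D * aJ J) (λ J → q * lJ J) Out) (cong₂ _+_ (wsum-*ˡ D aJ Out) (wsum-*ˡ q lJ Out)) ⟩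
        D * wsum Out aJ + q * wsum Out lJ
          ≡⟨ sym (cong₂ (λ a b → D * a + q * b) A≡ (byParts (λ K → ∑ K (e v) * ind K) (λ p → cong₂ _*_ (∑-↭ (e v) p) (ind-↭ p)))) ⟩
        D * wsum R (λ K → ind (v ∷ K)) + q * wsum R (λ K → ∑ K (e v) * ind K) ∎
        where
        open ≤-Reasoning
        aJ zJ lJ : List A → ℕ
        aJ J = q ^ length Nv * ind J
        zJ J = wsum Nv (λ K → ind (J ++ K))
        lJ J = wsum Nv (λ K → ∑ (J ++ K) (e v) * ind (J ++ K))
        byParts : ∀ f → (∀ {K L} → K ↭ L → f K ≡ f L) → wsum R f ≡ wsum Out (λ J → wsum Nv (λ K → f (J ++ K)))
        byParts f inv = trans (wsum-↭ inv R↭) (wsum-++ f Out Nv)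
        avoid-out : ∀ {J} → All (λ x → adj v x ≡ false) J → avoid v J ≡ 1
        avoid-out []       = refl
        avoid-out (p ∷ ps) rewrite p = trans (+-identityʳ _) (avoid-out ps)
        -- With v chosen all of `Nv` is excluded, so only its empty sublist survives, with weight
        -- q^|Nv|.
        A≡ : wsum R (λ K → ind (v ∷ K)) ≡ wsum Out aJ
        A≡ = trans (byParts (λ K → ind (v ∷ K)) (λ p → ind-↭ (prep v p))) (wsum-congᴬ o (λ {J} oJ →
          trans (wsum-vanish n (λ {x} K vx → van J vx K))
                (cong (q ^ length Nv *_) (trans (cong₂ _*_ (trans (avoid-++ v J []) (trans (*-identityʳ _) (avoid-out oJ)))
                                                           (trans (ind-++ J []) (*-identityʳ _)))
                                                (+-identityʳ _)))))
          where
          van : ∀ J {x} → adj v x ≡ true → ∀ K → ind (v ∷ (J ++ x ∷ K)) ≡ 0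
          van J {x} vx K = cong (_* ind (J ++ x ∷ K)) (trans (avoid-++ v J (x ∷ K))
            (trans (cong (λ z → avoid v J * (𝟙 (not z) * avoid v K)) vx) (*-zeroʳ (avoid v J))))
        -- On `Nv` the factors `e v u` are 1, so its ordered edges are among the triangles at v
        -- bounded by `tri`.
        edges : ∑ Nv (λ u → ∑ Nv (e u)) ≤ s
        edges = begin
          ∑ Nv (λ u → ∑ Nv (e u))
            ≡⟨ ∑-congᴬ (All.map (λ {u} vu → ∑-congᴬ (All.map (λ {u′} vu′ →
                 trans (sym (+-identityʳ (e u u′))) (sym (cong₂ (λ a b → 𝟙 a * 𝟙 b * e u u′) vu vu′))) n)) n) ⟩
          ∑ Nv (λ u → ∑ Nv (λ u′ → e v u * e v u′ * e u u′))
            ≤⟨ ∑-mono′ Nv (λ u → part (λ u′ → e v u * e v u′ * e u u′)) ⟩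
          ∑ Nv (λ u → ∑ R (λ u′ → e v u * e v u′ * e u u′))
            ≤⟨ part (λ u → ∑ R (λ u′ → e v u * e v u′ * e u u′)) ⟩
          ∑ R (λ u → ∑ R (λ u′ → e v u * e v u′ * e u u′))
            ≤⟨ tri ⟩
          s ∎
          where
          part : ∀ f → ∑ Nv f ≤ ∑ R f
          part f = ≤-trans (m≤n+m _ (∑ Out f)) (≤-reflexive (sym (trans (∑-↭ f R↭) (∑-++ f Out Nv))))
        conditional : ∀ J → c * (aJ J + q * zJ J) ≤ D * aJ J + q * lJ J
        conditional J with restrict J Nv
        ... | F , j , F⊆ , len , restr = begin
          c * (aJ J + q * zJ J)
            ≡⟨ cong (c *_) (cong₂ (λ a b → a * ind J + q * b) pow zJ≡) ⟩
          c * (q ^ j * q ^ length F * ind J + q * (ind J * (q ^ j * Z F)))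
            ≡⟨ lem₁ c (q ^ j) (q ^ length F) (ind J) q (Z F) ⟩
          ind J * q ^ j * (c * (q ^ length F + q * Z F))
            ≤⟨ *-monoʳ-≤ (ind J * q ^ j) (local-bound {k = k} b≡2k {m = length F} s≤ D≥ (Z≤ F)
                 (≤-trans (mean-size F) (+-monoʳ-≤ (suc q * (suc q * M F)) (*-monoˡ-≤ (Z F) edgesF)))) ⟩
          ind J * q ^ j * (D * q ^ length F + q * M F)
            ≡⟨ lem₂ D (q ^ j) (q ^ length F) (ind J) q (M F) ⟩
          D * (q ^ j * q ^ length F * ind J) + q * (ind J * (q ^ j * M F))
            ≤⟨ +-mono-≤ (≤-reflexive (cong (λ z → D * (z * ind J)) (sym pow))) (*-monoʳ-≤ q lJ≥) ⟩
          D * aJ J + q * lJ J ∎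
          where
          pow : q ^ length Nv ≡ q ^ j * q ^ length F
          pow = trans (cong (q ^_) len) (^-distribˡ-+-* q j (length F))
          edgesF : ∑ F (λ u → ∑ F (e u)) ≤ s
          edgesF = ≤-trans (∑-mono′ F (λ u → ∑-⊆ (e u) F⊆)) (≤-trans (∑-⊆ (λ u → ∑ Nv (e u)) F⊆) edges)
          zJ≡ : zJ J ≡ ind J * (q ^ j * Z F)
          zJ≡ = trans (wsum-cong Nv (ind-++ J)) (trans (wsum-*ˡ (ind J) _ Nv) (cong (ind J *_) (restr ind)))
          -- `J` is arbitrary here, so its contribution to the degree is dropped by an inequality;
          -- every member of `K` is a neighbour of v and counts fully.
          lJ≥ : ind J * (q ^ j * M F) ≤ lJ J
          lJ≥ = begin
            ind J * (q ^ j * M F)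
              ≡⟨ cong (ind J *_) (sym (restr (λ K → length K * ind K))) ⟩
            ind J * wsum Nv (λ K → cross J K * (length K * ind K))
              ≡⟨ sym (wsum-*ˡ (ind J) _ Nv) ⟩
            wsum Nv (λ K → ind J * (cross J K * (length K * ind K)))
              ≤⟨ wsum-mono n (λ {K} nK → begin
                   ind J * (cross J K * (length K * ind K))     ≡⟨ lem₃ (ind J) (cross J K) (length K) (ind K) ⟩
                   length K * (ind J * (cross J K * ind K))     ≡⟨ cong₂ _*_ (sym (deg nK)) (sym (ind-++ J K)) ⟩
                   ∑ K (e v) * ind (J ++ K)                     ≤⟨ *-monoˡ-≤ (ind (J ++ K)) (≤-trans (m≤n+m _ (∑ J (e v))) (≤-reflexive (sym (∑-++ (e v) J K)))) ⟩
                   ∑ (J ++ K) (e v) * ind (J ++ K)              ∎) ⟩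
            lJ J ∎
            where
            deg : ∀ {K} → All (λ x → adj v x ≡ true) K → ∑ K (e v) ≡ length K
            deg []       = refl
            deg (p ∷ ps) = cong₂ _+_ (cong 𝟙 p) (deg ps)
            lem₃ : ∀ a b c d → a * (b * (c * d)) ≡ c * (a * (b * d))
            lem₃ = solve-∀
          lem₁ : ∀ c x y i q z → c * (x * y * i + q * (i * (x * z))) ≡ i * x * (c * (y + q * z))
          lem₁ = solve-∀
          lem₂ : ∀ D x y i q z → i * x * (D * y + q * z) ≡ D * (x * y * i) + q * (i * (x * z))
          lem₂ = solve-∀

      module _ (xs : List A) (deg≤ : ∀ {v} → v ∈ xs → ∑ xs (e v) ≤ D)
               (tri≤ : ∀ {v} → v ∈ xs → ∑ xs (λ u → ∑ xs (λ u′ → e v u * e v u′ * e u u′)) ≤ s) where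

        -- Summing over v and exchanging the sums turns E|I ∩ N(v)| into the sum of the degrees of
        -- the members of I, at most D|I|; the terms D P(v ∈ I) give another D|I|.
        average-bound : c * (length xs * Z xs) ≤ 2 * D * M xs
        average-bound = begin
          c * (length xs * Z xs)
            ≡⟨ cong (c *_) (sym (trans (∑-picks (const (Z xs)) xs) (∑-const (Z xs) xs))) ⟩
          c * ∑ (picks xs) (const (Z xs))
            ≡⟨ sym (∑-*ˡ c _ (picks xs)) ⟩
          ∑ (picks xs) (λ _ → c * Z xs)
            ≤⟨ ∑-mono (All.map (λ {(v , R)} → vertex v R) (picks-↭ xs)) ⟩
          ∑ (picks xs) (λ vR → D * P vR + wsum xs (λ K → ∑ K (e (proj₁ vR)) * ind K))
            ≡⟨ trans (∑-+ (λ vR → D * P vR) _ (picks xs)) (cong₂ _+_ (trans (∑-*ˡ D P (picks xs)) (cong (D *_) (∑-occupation xs)))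
                 (∑-picks (λ v → wsum xs (λ K → ∑ K (e v) * ind K)) xs)) ⟩
          D * M xs + ∑ xs (λ v → wsum xs (λ K → ∑ K (e v) * ind K))
            ≡⟨ cong (D * M xs +_) (sym (wsum-∑ (λ K v → ∑ K (e v) * ind K) xs xs)) ⟩
          D * M xs + wsum xs (λ K → ∑ xs (λ v → ∑ K (e v) * ind K))
            ≤⟨ +-monoʳ-≤ (D * M xs) (wsum-mono (All.tabulate (λ v∈ → v∈)) (λ {K} K⊆ → begin
                 ∑ xs (λ v → ∑ K (e v) * ind K)     ≡⟨ ∑-*ʳ (ind K) (λ v → ∑ K (e v)) xs ⟩
                 ∑ xs (λ v → ∑ K (e v)) * ind K     ≡⟨ cong (_* ind K) (∑-swap e xs K) ⟩
                 ∑ K (λ x → ∑ xs (λ v → e v x)) * ind K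
                   ≤⟨ *-monoˡ-≤ (ind K) (∑-mono {g = const D} (All.map (λ {x} x∈ →
                        ≤-trans (≤-reflexive (∑-cong xs (λ v → cong 𝟙 (adj-sym v x)))) (deg≤ x∈)) K⊆)) ⟩
                 ∑ K (const D) * ind K              ≡⟨ cong (_* ind K) (trans (∑-const D K) (*-comm (length K) D)) ⟩
                 D * length K * ind K               ≡⟨ *-assoc D (length K) (ind K) ⟩
                 D * (length K * ind K)             ∎)) ⟩
          D * M xs + wsum xs (λ K → D * (length K * ind K))
            ≡⟨ cong (D * M xs +_) (wsum-*ˡ D _ xs) ⟩
          D * M xs + D * M xs
            ≡⟨ lem D (M xs) ⟩
          2 * D * M xs ∎
          where
          open ≤-Reasoning
          lem : ∀ d m → d * m + d * m ≡ 2 * d * m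
          lem = solve-∀
          P : A × List A → ℕ
          P (u , R) = wsum R (λ K → ind (u ∷ K))
          vertex : ∀ v R → xs ↭ v ∷ R → c * Z xs ≤ D * P (v , R) + wsum xs (λ K → ∑ K (e v) * ind K)
          vertex v R p = begin
            c * Z xs
              ≡⟨ cong (c *_) (wsum-↭ ind-↭ p) ⟩
            c * (P (v , R) + q * Z R)
              ≤⟨ vertex-bound v R (≤-trans (≤-trans (∑-mono′ R (λ u → sub _)) (sub _)) (tri≤ (∈-resp-↭ (↭-sym p) (here refl)))) ⟩
            D * P (v , R) + q * wsum R (λ K → ∑ K (e v) * ind K)
              -- The sets omitting v carry the factor q in `wsum xs`; those containing v are added
              -- to complete the sum.
              ≤⟨ +-monoʳ-≤ (D * P (v , R)) (≤-trans (m≤n+m _ _) (≤-reflexive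
                   (sym (wsum-↭ (λ p′ → cong₂ _*_ (∑-↭ (e v) p′) (ind-↭ p′)) p)))) ⟩
            D * P (v , R) + wsum xs (λ K → ∑ K (e v) * ind K) ∎
            where
            sub : ∀ f → ∑ R f ≤ ∑ xs f
            sub f = ≤-trans (m≤n+m _ (f v)) (≤-reflexive (sym (∑-↭ f p)))

        -- The summand 1 on the right adds the positive `Z xs` and makes the comparison of totals
        -- strict, as `wsum-extract` requires; integrality removes it again at the set found.
        large-independent : ∃ λ I → I ⊆ xs × ind I ≡ 1 × c * length xs ≤ 2 * D * length I
        large-independent with wsum-extract (λ K → c * length xs * ind K) (λ K → (1 + 2 * D * length K) * ind K) xs (begin-strict
            wsum xs (λ K → c * length xs * ind K)     ≡⟨ wsum-*ˡ (c * length xs) ind xs ⟩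
            c * length xs * Z xs                      ≡⟨ *-assoc c (length xs) (Z xs) ⟩
            c * (length xs * Z xs)                    ≤⟨ average-bound ⟩
            2 * D * M xs                              <⟨ m<n+m _ Z>0 ⟩
            Z xs + 2 * D * M xs                       ≡⟨ cong (Z xs +_) (sym (wsum-*ˡ (2 * D) _ xs)) ⟩
            Z xs + wsum xs (λ K → 2 * D * (length K * ind K)) ≡⟨ sym (wsum-+ _ _ xs) ⟩
            wsum xs (λ K → ind K + 2 * D * (length K * ind K)) ≡⟨ wsum-cong xs (λ K → cong (ind K +_) (sym (*-assoc (2 * D) (length K) (ind K)))) ⟩
            wsum xs (λ K → (1 + 2 * D * length K) * ind K) ∎)
          where
          open ≤-Reasoning
          Z>0 : 0 < Z xs
          Z>0 = ≤-trans (m^n>0 q (length xs)) (≤-trans (≤-reflexive (sym (*-identityʳ _))) (wsum-[] ind xs))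
        ... | I , I⊆ , lt = I , I⊆ , <⇒ind≡1 I {c * length xs} {1 + 2 * D * length I} lt , ≤-pred (*-cancelʳ-< (ind I) (c * length xs) (1 + 2 * D * length I) lt)

-- Counting words

δ : ℕ → ℕ → ℕ
δ m n = 𝟙 (m ≡ᵇ n)

δ-refl : ∀ {m n} → m ≡ n → δ m n ≡ 1
δ-refl {zero}  refl = refl
δ-refl {suc m} refl = δ-refl {m} refl

δ-≢ : ∀ {m n} → m ≢ n → δ m n ≡ 0
δ-≢ {m} {n} m≢n with m ≡ᵇ n in eq
... | true  = contradiction (≡ᵇ⇒≡ m n (subst T (sym eq) _)) m≢n
... | false = refl

δ*≤ : ∀ {m n a b} → (m ≡ n → a ≤ b) → δ m n * a ≤ b
δ*≤ {m} {n} {a} {b} a≤b with m ≟ n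
... | yes m≡n = ≤-trans (≤-reflexive (trans (cong (_* a) (δ-refl m≡n)) (+-identityʳ a))) (a≤b m≡n)
... | no  m≢n = ≤-trans (≤-reflexive (cong (_* a) (δ-≢ m≢n))) z≤n

𝟙≤ : ∀ b {a} → (b ≡ true → 1 ≤ a) → 𝟙 b ≤ a
𝟙≤ true  p = p refl
𝟙≤ false p = z≤n

∑-∈ : ∀ {B : Set} (f : B → ℕ) {x xs} → x ∈ xs → f x ≤ ∑ xs f
∑-∈ f (here refl) = m≤m+n _ _
∑-∈ f (there p)   = ≤-trans (∑-∈ f p) (m≤n+m _ _)

term≤sumFromTo : ∀ {a b l} f → a ≤ l → l ≤ b → f l ≤ sumFromTo a b f
term≤sumFromTo {a} {b} {l} f a≤l l≤b =
  ≤-trans (≤-reflexive (cong f (sym (m+[n∸m]≡n a≤l))))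
          (∑-∈ (λ t → f (a + t)) (∈-upTo⁺ (∸-monoˡ-< (s≤s l≤b) a≤l)))

sumFromTo-cons : ∀ r f → sumFromTo 0 r f ≡ f 0 + sumFromTo 1 r f
sumFromTo-cons r f = cong (λ xs → f 0 + sum xs) (begin
  map f (applyUpTo suc r)           ≡⟨ cong (map f) (sym (map-upTo suc r)) ⟩
  map f (map suc (upTo r))          ≡⟨ sym (map-∘ (upTo r)) ⟩
  map (λ t → f (1 + t)) (upTo r)    ∎)
  where open ≡-Reasoning

allWords : ∀ n → List (Vec Bool n)
allWords zero    = [] ∷ []
allWords (suc n) = map (true ∷_) (allWords n) ++ map (false ∷_) (allWords n)

words : ∀ n w → List (Vec Bool n)
words n w = filter (λ y → weight y ≟ w) (allWords n)

∑-allWords : ∀ {n} (f : Vec Bool (suc n) → ℕ) →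
  ∑ (allWords (suc n)) f ≡ ∑ (allWords n) (f ∘ (true ∷_)) + ∑ (allWords n) (f ∘ (false ∷_))
∑-allWords {n} f = trans (∑-++ f (map (true ∷_) (allWords n)) _) (cong₂ _+_ (∑-map f _ (allWords n)) (∑-map f _ (allWords n)))

-- The induction step on word length shared by all counts below: a new coordinate in the cell
-- counted by `E` is either hit or missed, which is Pascal's rule. `R` carries the constraints on
-- the other cells.
pascal-∑ : ∀ {B : Set} (ys : List B) {m Q} (E R : B → ℕ) →
  (∀ a → ∑ ys (λ y → δ (E y) a * R y) ≡ (m C a) * Q) →
  ∀ a → ∑ ys (λ y → δ (suc (E y)) a * R y) + ∑ ys (λ y → δ (E y) a * R y) ≡ (suc m C a) * Q
pascal-∑ ys         E R ih zero    = cong₂ _+_ (trans (∑-const 0 ys) (*-zeroʳ (length ys))) (ih 0)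
pascal-∑ ys {m} {Q} E R ih (suc a) = trans (cong₂ _+_ (ih a) (ih (suc a)))
  (trans (sym (*-distribʳ-+ Q (m C a) (m C suc a))) (cong (_* Q) (nCk+nC[k+1]≡[n+1]C[k+1] m a)))

δ0≡0C : ∀ a → δ 0 a ≡ 0 C a
δ0≡0C zero    = refl
δ0≡0C (suc a) = refl

∑-weight : ∀ n w → ∑ (allWords n) (λ y → δ (weight y) w * 1) ≡ (n C w) * 1
∑-weight zero    w = trans (+-identityʳ _) (cong (_* 1) (δ0≡0C w))
∑-weight (suc n) w = trans (∑-allWords {n} (λ y → δ (weight y) w * 1)) (pascal-∑ (allWords n) {n} weight (const 1) (∑-weight n) w)

length-filter : ∀ {B : Set} {P : B → Set} (P? : Decidable P) xs → length (filter P? xs) ≡ ∑ xs (λ x → 𝟙 (does (P? x)))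
length-filter P? []       = refl
length-filter P? (x ∷ xs) with does (P? x)
... | true  = cong suc (length-filter P? xs)
... | false = length-filter P? xs

length-words : ∀ n w → length (words n w) ≡ n C w
length-words n w = begin
  length (words n w)                          ≡⟨ length-filter (λ y → weight y ≟ w) (allWords n) ⟩
  ∑ (allWords n) (λ y → δ (weight y) w)       ≡⟨ ∑-cong (allWords n) (λ y → sym (*-identityʳ (δ (weight y) w))) ⟩
  ∑ (allWords n) (λ y → δ (weight y) w * 1)   ≡⟨ ∑-weight n w ⟩
  (n C w) * 1                                 ≡⟨ *-identityʳ _ ⟩
  n C w                                       ∎
  where open ≡-Reasoning

words-weight : ∀ n w → All (λ y → weight y ≡ w) (words n w)
words-weight n w = All.all-filter (λ y → weight y ≟ w) (allWords n)

allWords-unique : ∀ n → Unique (allWords n)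
allWords-unique zero    = [] ∷ []
allWords-unique (suc n) = Unique.++⁺ (Unique.map⁺ ∷-injectiveʳ (allWords-unique n)) (Unique.map⁺ ∷-injectiveʳ (allWords-unique n))
  λ (p , p′) → disjoint (∈-map⁻ (true ∷_) p) (∈-map⁻ (false ∷_) p′)
  where
  disjoint : ∀ {v : Vec Bool (suc n)} → ∃ (λ x → x ∈ allWords n × v ≡ true ∷ x) → ∃ (λ x → x ∈ allWords n × v ≡ false ∷ x) → ⊥
  disjoint (_ , _ , refl) (_ , _ , ())

words-unique : ∀ n w → Unique (words n w)
words-unique n w = Unique.filter⁺ (λ y → weight y ≟ w) (allWords-unique n)

same : Bool → Bool → Bool
same true  b = b
same false b = not b

-- Two words x and z cut the coordinates into four cells by the values (a, b). `sz` is the size of a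
-- cell, and `ct` counts its coordinates where a third word y has value t.
sz : Bool → Bool → ∀ {n} → Vec Bool n → Vec Bool n → ℕ
sz a b []       []       = 0
sz a b (p ∷ x) (q ∷ z) = 𝟙 (same a p ∧ same b q) + sz a b x z

ct : Bool → Bool → Bool → ∀ {n} → Vec Bool n → Vec Bool n → Vec Bool n → ℕ
ct a b t []       []       []      = 0
ct a b t (p ∷ x) (q ∷ z) (r ∷ y) = 𝟙 (same a p ∧ same b q ∧ same t r) + ct a b t x z y

-- In the cell x = z = 1 it is the zeros of y that are counted, so that the
-- binomial coefficients come out as in p.
profile : ∀ {n} (x z y : Vec Bool n) (α β γ l : ℕ) → ℕ
profile x z y α β γ l =
  δ (ct true true false x z y) α * (δ (ct true false true x z y) β *
    (δ (ct false true true x z y) γ * δ (ct false false true x z y) l))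

binomials : ∀ {n} (x z : Vec Bool n) (α β γ l : ℕ) → ℕ
binomials x z α β γ l =
  (sz true true x z C α) * ((sz true false x z C β) * ((sz false true x z C γ) * (sz false false x z C l)))

-- The restrictions of y to the four cells are independent, whence one binomial coefficient per
-- cell.
∑-profile : ∀ {n} (x z : Vec Bool n) α β γ l →
  ∑ (allWords n) (λ y → profile x z y α β γ l) ≡ binomials x z α β γ l
∑-profile [] [] α β γ l = trans (+-identityʳ _)
  (cong₂ _*_ (δ0≡0C α) (cong₂ _*_ (δ0≡0C β) (cong₂ _*_ (δ0≡0C γ) (δ0≡0C l))))
-- In this cell zeros are counted, so the `false` branch raises the count and the two sums must be
-- exchanged.
∑-profile {suc n} (true ∷ x) (true ∷ z) α β γ l = trans (∑-allWords (λ y → profile (true ∷ x) (true ∷ z) y α β γ l)) (trans (+-comm (∑ (allWords n) (λ y → profile x z y α β γ l)) _)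
  (pascal-∑ (allWords n) {sz true true x z} (ct true true false x z) r (λ a → ∑-profile x z a β γ l) α))
  where
  r : Vec Bool n → ℕ
  r y = δ (ct true false true x z y) β * (δ (ct false true true x z y) γ * δ (ct false false true x z y) l)
∑-profile {suc n} (true ∷ x) (false ∷ z) α β γ l = trans (∑-allWords (λ y → profile (true ∷ x) (false ∷ z) y α β γ l))
  (trans (cong₂ _+_ (∑-cong (allWords n) (λ y → mv (c1 y) (δ (suc (ct true false true x z y)) β) (r y)))
                    (∑-cong (allWords n) (λ y → mv (c1 y) (δ (ct true false true x z y) β) (r y))))
  (trans (pascal-∑ (allWords n) {m} (ct true false true x z) (λ y → c1 y * r y)
            (λ b → trans (∑-cong (allWords n) (λ y → sym (mv (c1 y) (δ (ct true false true x z y) b) (r y))))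
                   (trans (∑-profile x z α b γ l) (mv A (m C b) G))) β)
         (sym (mv A (suc m C β) G))))
  where
  m = sz true false x z
  A = sz true true x z C α
  G = (sz false true x z C γ) * (sz false false x z C l)
  c1 r : Vec Bool n → ℕ
  c1 y = δ (ct true true false x z y) α
  r y = δ (ct false true true x z y) γ * δ (ct false false true x z y) l
  mv : ∀ a b c → a * (b * c) ≡ b * (a * c)
  mv = solve-∀
∑-profile {suc n} (false ∷ x) (true ∷ z) α β γ l = trans (∑-allWords (λ y → profile (false ∷ x) (true ∷ z) y α β γ l))
  (trans (cong₂ _+_ (∑-cong (allWords n) (λ y → mv (c1 y) (c2 y) (δ (suc (ct false true true x z y)) γ) (c4 y)))
                    (∑-cong (allWords n) (λ y → mv (c1 y) (c2 y) (δ (ct false true true x z y) γ) (c4 y))))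
  (trans (pascal-∑ (allWords n) {m} (ct false true true x z) (λ y → c1 y * (c2 y * c4 y))
            (λ c → trans (∑-cong (allWords n) (λ y → sym (mv (c1 y) (c2 y) (δ (ct false true true x z y) c) (c4 y))))
                   (trans (∑-profile x z α β c l) (mv A B (m C c) D))) γ)
         (sym (mv A B (suc m C γ) D))))
  where
  m = sz false true x z
  A = sz true true x z C α
  B = sz true false x z C β
  D = sz false false x z C l
  c1 c2 c4 : Vec Bool n → ℕ
  c1 y = δ (ct true true false x z y) α
  c2 y = δ (ct true false true x z y) β
  c4 y = δ (ct false false true x z y) l
  mv : ∀ a b c d → a * (b * (c * d)) ≡ c * (a * (b * d))
  mv = solve-∀
∑-profile {suc n} (false ∷ x) (false ∷ z) α β γ l = trans (∑-allWords (λ y → profile (false ∷ x) (false ∷ z) y α β γ l))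
  (trans (cong₂ _+_ (∑-cong (allWords n) (λ y → mv (c1 y) (c2 y) (c3 y) (δ (suc (ct false false true x z y)) l)))
                    (∑-cong (allWords n) (λ y → mv (c1 y) (c2 y) (c3 y) (δ (ct false false true x z y) l))))
  (trans (pascal-∑ (allWords n) {m} (ct false false true x z) (λ y → c1 y * (c2 y * c3 y))
            (λ d → trans (∑-cong (allWords n) (λ y → sym (mv (c1 y) (c2 y) (c3 y) (δ (ct false false true x z y) d))))
                   (trans (∑-profile x z α β γ d) (mv A B D (m C d)))) l)
         (sym (mv A B D (suc m C l)))))
  where
  m = sz false false x z
  A = sz true true x z C α
  B = sz true false x z C β
  D = sz false true x z C γ
  c1 c2 c3 : Vec Bool n → ℕ
  c1 y = δ (ct true true false x z y) α
  c2 y = δ (ct true false true x z y) β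
  c3 y = δ (ct false true true x z y) γ
  mv : ∀ a b c d → a * (b * (c * d)) ≡ d * (a * (b * c))
  mv = solve-∀

-- Distances, cell counts and the numbers p

-- For words of equal weight, half their distance.
h : ∀ {n} → Vec Bool n → Vec Bool n → ℕ
h = sz false true

dist≡ : ∀ {n} (x y : Vec Bool n) → dist x y ≡ h x y + h y x
dist≡ []          []          = refl
dist≡ (true ∷ x)  (true ∷ y)  = dist≡ x y
dist≡ (true ∷ x)  (false ∷ y) = trans (cong suc (dist≡ x y)) (sym (+-suc (h x y) (h y x)))
dist≡ (false ∷ x) (true ∷ y)  = cong suc (dist≡ x y)
dist≡ (false ∷ x) (false ∷ y) = dist≡ x y

weight+h : ∀ {n} (x y : Vec Bool n) → weight x + h x y ≡ weight y + h y x
weight+h []          []          = refl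
weight+h (true ∷ x)  (true ∷ y)  = cong suc (weight+h x y)
weight+h (true ∷ x)  (false ∷ y) = trans (cong suc (weight+h x y)) (sym (+-suc (weight y) (h y x)))
weight+h (false ∷ x) (true ∷ y)  = trans (+-suc (weight x) (h x y)) (cong suc (weight+h x y))
weight+h (false ∷ x) (false ∷ y) = weight+h x y

-- Equal weights force as many ones to be gained as lost.
dist≡2h : ∀ {n} (x y : Vec Bool n) → weight x ≡ weight y → dist x y ≡ 2 * h x y
dist≡2h x y wt = trans (dist≡ x y) (cong (h x y +_) (trans (sym h≡) (sym (+-identityʳ (h x y)))))
  where
  h≡ : h x y ≡ h y x
  h≡ = +-cancelˡ-≡ (weight x) _ _ (trans (weight+h x y) (cong (_+ h y x) (sym wt)))

dist-sym : ∀ {n} (x y : Vec Bool n) → dist x y ≡ dist y x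
dist-sym x y = trans (dist≡ x y) (trans (+-comm (h x y) _) (sym (dist≡ y x)))

dist-self : ∀ {n} (x : Vec Bool n) → dist x x ≡ 0
dist-self []          = refl
dist-self (true ∷ x)  = dist-self x
dist-self (false ∷ x) = dist-self x

dist≡0⇒≡ : ∀ {n} (x y : Vec Bool n) → dist x y ≡ 0 → x ≡ y
dist≡0⇒≡ []          []          _ = refl
dist≡0⇒≡ (true ∷ x)  (true ∷ y)  p = cong (true ∷_) (dist≡0⇒≡ x y p)
dist≡0⇒≡ (false ∷ x) (false ∷ y) p = cong (false ∷_) (dist≡0⇒≡ x y p)

weight≡ˡ : ∀ {n} (x z : Vec Bool n) → weight x ≡ sz true true x z + sz true false x z
weight≡ˡ []          []          = refl
weight≡ˡ (true ∷ x)  (true ∷ z)  = cong suc (weight≡ˡ x z)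
weight≡ˡ (true ∷ x)  (false ∷ z) = trans (cong suc (weight≡ˡ x z)) (sym (+-suc (sz true true x z) _))
weight≡ˡ (false ∷ x) (true ∷ z)  = weight≡ˡ x z
weight≡ˡ (false ∷ x) (false ∷ z) = weight≡ˡ x z

weight≡ʳ : ∀ {n} (x z : Vec Bool n) → weight z ≡ sz true true x z + sz false true x z
weight≡ʳ []          []          = refl
weight≡ʳ (true ∷ x)  (true ∷ z)  = cong suc (weight≡ʳ x z)
weight≡ʳ (true ∷ x)  (false ∷ z) = weight≡ʳ x z
weight≡ʳ (false ∷ x) (true ∷ z)  = trans (cong suc (weight≡ʳ x z)) (sym (+-suc (sz true true x z) _))
weight≡ʳ (false ∷ x) (false ∷ z) = weight≡ʳ x z

size≡ : ∀ {n} (x z : Vec Bool n) → n ≡ weight x + sz false true x z + sz false false x z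
size≡ []          []          = refl
size≡ (true ∷ x)  (true ∷ z)  = cong suc (size≡ x z)
size≡ (true ∷ x)  (false ∷ z) = cong suc (size≡ x z)
size≡ (false ∷ x) (true ∷ z)  = trans (cong suc (size≡ x z)) (cong (_+ sz false false x z) (sym (+-suc (weight x) _)))
size≡ (false ∷ x) (false ∷ z) = trans (cong suc (size≡ x z)) (sym (+-suc (weight x + sz false true x z) _))

ct≤sz : ∀ a b t {n} (x z y : Vec Bool n) → ct a b t x z y ≤ sz a b x z
ct≤sz a b t []       []       []       = z≤n
ct≤sz a b t (p ∷ x) (q ∷ z) (r ∷ y) = +-mono-≤ (head (same a p) (same b q) (same t r)) (ct≤sz a b t x z y)
  where
  head : ∀ u v w → 𝟙 (u ∧ v ∧ w) ≤ 𝟙 (u ∧ v)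
  head true  true  true  = ≤-refl
  head true  true  false = z≤n
  head true  false w     = z≤n
  head false v     w     = z≤n

hˡ≡ : ∀ {n} (x z y : Vec Bool n) → h x y ≡ ct false true true x z y + ct false false true x z y
hˡ≡ []          []          []          = refl
hˡ≡ (false ∷ x) (true ∷ z)  (true ∷ y)  = cong suc (hˡ≡ x z y)
hˡ≡ (false ∷ x) (false ∷ z) (true ∷ y)  = trans (cong suc (hˡ≡ x z y)) (sym (+-suc (ct false true true x z y) _))
hˡ≡ (false ∷ x) (true ∷ z)  (false ∷ y) = hˡ≡ x z y
hˡ≡ (false ∷ x) (false ∷ z) (false ∷ y) = hˡ≡ x z y
hˡ≡ (true ∷ x)  (_ ∷ z)     (_ ∷ y)     = hˡ≡ x z y

hʳ≡ : ∀ {n} (x z y : Vec Bool n) → h z y ≡ ct true false true x z y + ct false false true x z y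
hʳ≡ []          []          []          = refl
hʳ≡ (true ∷ x)  (false ∷ z) (true ∷ y)  = cong suc (hʳ≡ x z y)
hʳ≡ (false ∷ x) (false ∷ z) (true ∷ y)  = trans (cong suc (hʳ≡ x z y)) (sym (+-suc (ct true false true x z y) _))
hʳ≡ (true ∷ x)  (false ∷ z) (false ∷ y) = hʳ≡ x z y
hʳ≡ (false ∷ x) (false ∷ z) (false ∷ y) = hʳ≡ x z y
hʳ≡ (true ∷ x)  (true ∷ z)  (_ ∷ y)     = hʳ≡ x z y
hʳ≡ (false ∷ x) (true ∷ z)  (_ ∷ y)     = hʳ≡ x z y

-- The ones of y cell by cell; since zeros are counted in the cell x = z = 1, their number is added
-- on the left instead of subtracted on the right.
weight-profile : ∀ {n} (x z y : Vec Bool n) → weight y + ct true true false x z y ≡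
  sz true true x z + (ct true false true x z y + ct false true true x z y + ct false false true x z y)
weight-profile []          []          []          = refl
weight-profile (true ∷ x)  (true ∷ z)  (true ∷ y)  = cong suc (weight-profile x z y)
weight-profile (true ∷ x)  (true ∷ z)  (false ∷ y) = trans (+-suc (weight y) _) (cong suc (weight-profile x z y))
weight-profile (true ∷ x)  (false ∷ z) (true ∷ y)  = trans (cong suc (weight-profile x z y)) (sym (+-suc (sz true true x z) _))
weight-profile (true ∷ x)  (false ∷ z) (false ∷ y) = weight-profile x z y
weight-profile (false ∷ x) (true ∷ z)  (true ∷ y)  = trans (cong suc (weight-profile x z y))
  (lem (sz true true x z) (ct true false true x z y) (ct false true true x z y) (ct false false true x z y))
  where
  lem : ∀ a b c d → suc (a + (b + c + d)) ≡ a + (b + suc c + d)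
  lem = solve-∀
weight-profile (false ∷ x) (true ∷ z)  (false ∷ y) = weight-profile x z y
weight-profile (false ∷ x) (false ∷ z) (true ∷ y)  = trans (cong suc (weight-profile x z y))
  (lem (sz true true x z) (ct true false true x z y) (ct false true true x z y) (ct false false true x z y))
  where
  lem : ∀ a b c d → suc (a + (b + c + d)) ≡ a + (b + c + suc d)
  lem = solve-∀
weight-profile (false ∷ x) (false ∷ z) (false ∷ y) = weight-profile x z y

-- Together with `p-term`, these name the limits and the summand that are local to `p`.
p-lower p-upper : (n w k i j : ℕ) → ℕ
p-lower n w k i j = 0 ⊔ (i ∸ k) ⊔ (j ∸ k) ⊔ (i + j ∸ w)
p-upper n w k i j = i ⊓ j ⊓ (i + j ∸ k) ⊓ (n ∸ w ∸ k)

p-term : (n w k i j l : ℕ) → ℕ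
p-term n w k i j l = ((n ∸ w ∸ k) C l) * (k C (i ∸ l)) * (k C (j ∸ l)) * ((w ∸ k) C (i + j ∸ k ∸ l))

p≡ : ∀ n w k i j → k ≤ i + j → p n w k i j ≡ sumFromTo (p-lower n w k i j) (p-upper n w k i j) (p-term n w k i j)
p≡ n w k i j k≤ with k ≤ᵇ i + j | ≤⇒≤ᵇ k≤
... | true | _ = refl

module _ {n w k} (x z : Vec Bool n) (wx : weight x ≡ w) (wz : weight z ≡ w) (hxz : h x z ≡ k) where

  private
    s₁ = sz true true x z
    s₂ = sz true false x z
    s₄ = sz false false x z

    w≡ : w ≡ s₁ + k
    w≡ = trans (sym wz) (trans (weight≡ʳ x z) (cong (s₁ +_) hxz))

    s₂≡ : s₂ ≡ k
    s₂≡ = +-cancelˡ-≡ s₁ _ _ (trans (sym (weight≡ˡ x z)) (trans wx w≡))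

    s₁≡ : s₁ ≡ w ∸ k
    s₁≡ = sym (trans (cong (_∸ k) w≡) (m+n∸n≡m s₁ k))

    s₄≡ : s₄ ≡ n ∸ w ∸ k
    s₄≡ = sym (begin
      n ∸ w ∸ k                   ≡⟨ cong (λ m → m ∸ w ∸ k) (trans (size≡ x z) (cong₂ (λ a b → a + b + s₄) wx hxz)) ⟩
      w + k + s₄ ∸ w ∸ k          ≡⟨ cong (λ m → m ∸ w ∸ k) (+-assoc w k s₄) ⟩
      w + (k + s₄) ∸ w ∸ k        ≡⟨ cong (_∸ k) (m+n∸m≡n w (k + s₄)) ⟩
      k + s₄ ∸ k                  ≡⟨ m+n∸m≡n k s₄ ⟩
      s₄                          ∎)
      where open ≡-Reasoning

  -- For words x, z of weight w at half-distance k the cells have sizes w - k, k, k and n - w - k,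
  -- which are the upper entries of the binomials in `p`.
  binomials≡p-term : ∀ i j l → binomials x z (i + j ∸ k ∸ l) (j ∸ l) (i ∸ l) l ≡ p-term n w k i j l
  binomials≡p-term i j l rewrite s₁≡ | s₂≡ | hxz | s₄≡ =
    lem ((w ∸ k) C (i + j ∸ k ∸ l)) (k C (j ∸ l)) (k C (i ∸ l)) ((n ∸ w ∸ k) C l)
    where
    lem : ∀ a b c d → a * (b * (c * d)) ≡ d * c * b * a
    lem = solve-∀

  module _ {y} (wy : weight y ≡ w) {i j} (hxy : h x y ≡ i) (hzy : h z y ≡ j) where

    private
      e₁ = ct true true false x z y
      e₂ = ct true false true x z y
      e₃ = ct false true true x z y
      e₄ = ct false false true x z y

      i≡ : i ≡ e₃ + e₄
      i≡ = trans (sym hxy) (hˡ≡ x z y)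

      j≡ : j ≡ e₂ + e₄
      j≡ = trans (sym hzy) (hʳ≡ x z y)

      k+e₁≡ : k + e₁ ≡ e₂ + e₃ + e₄
      k+e₁≡ = +-cancelˡ-≡ s₁ _ _ (trans (sym (+-assoc s₁ k e₁))
        (trans (cong (_+ e₁) (trans (sym w≡) (sym wy))) (weight-profile x z y)))

      i+j≡ : i + j ≡ k + (e₄ + e₁)
      i+j≡ = begin
        i + j                   ≡⟨ cong₂ _+_ i≡ j≡ ⟩
        e₃ + e₄ + (e₂ + e₄)     ≡⟨ lem₁ e₂ e₃ e₄ ⟩
        e₄ + (e₂ + e₃ + e₄)     ≡⟨ cong (e₄ +_) (sym k+e₁≡) ⟩
        e₄ + (k + e₁)           ≡⟨ lem₂ e₄ k e₁ ⟩
        k + (e₄ + e₁)           ∎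
        where
        open ≡-Reasoning
        lem₁ : ∀ a b c → b + c + (a + c) ≡ c + (a + b + c)
        lem₁ = solve-∀
        lem₂ : ∀ a b c → a + (b + c) ≡ b + (a + c)
        lem₂ = solve-∀

      i+j∸k≡ : i + j ∸ k ≡ e₄ + e₁
      i+j∸k≡ = trans (cong (_∸ k) i+j≡) (m+n∸m≡n k (e₄ + e₁))

    -- The triangle inequality for half-distances, matching the range where `p` is not set to 0.
    k≤i+j : k ≤ i + j
    k≤i+j = ≤-trans (m≤m+n k _) (≤-reflexive (sym i+j≡))

    -- The index l of `p` is the number `e₄` of ones of y outside both x and z; i, j and k then
    -- determine the other three counts. The limits of summation hold because no count exceeds the
    -- size of its cell.
    profile-counted : 1 ≤ sumFromTo (p-lower n w k i j) (p-upper n w k i j)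
                            (λ l → profile x z y (i + j ∸ k ∸ l) (j ∸ l) (i ∸ l) l)
    profile-counted = ≤-trans (≤-reflexive (sym one))
      (term≤sumFromTo (λ l → profile x z y (i + j ∸ k ∸ l) (j ∸ l) (i ∸ l) l) lower upper)
      where
      one : profile x z y (i + j ∸ k ∸ e₄) (j ∸ e₄) (i ∸ e₄) e₄ ≡ 1
      one = cong₂ _*_ (δ-refl (sym (trans (cong (_∸ e₄) i+j∸k≡) (m+n∸m≡n e₄ e₁))))
           (cong₂ _*_ (δ-refl (sym (trans (cong (_∸ e₄) j≡) (m+n∸n≡m e₂ e₄))))
           (cong₂ _*_ (δ-refl (sym (trans (cong (_∸ e₄) i≡) (m+n∸n≡m e₃ e₄))))
                      (δ-refl {e₄} refl)))
      e₃≤k : e₃ ≤ k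
      e₃≤k = ≤-trans (ct≤sz false true true x z y) (≤-reflexive hxz)
      e₂≤k : e₂ ≤ k
      e₂≤k = ≤-trans (ct≤sz true false true x z y) (≤-reflexive s₂≡)
      lower : p-lower n w k i j ≤ e₄
      lower = ⊔-lub (⊔-lub
        (m≤n+o⇒m∸n≤o i k (≤-trans (≤-reflexive i≡) (+-monoˡ-≤ e₄ e₃≤k)))
        (m≤n+o⇒m∸n≤o j k (≤-trans (≤-reflexive j≡) (+-monoˡ-≤ e₄ e₂≤k))))
        (m≤n+o⇒m∸n≤o (i + j) w (begin
          i + j           ≡⟨ i+j≡ ⟩
          k + (e₄ + e₁)   ≤⟨ +-monoʳ-≤ k (+-monoʳ-≤ e₄ (ct≤sz true true false x z y)) ⟩
          k + (e₄ + s₁)   ≡⟨ lem k e₄ s₁ ⟩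
          s₁ + k + e₄     ≡⟨ cong (_+ e₄) (sym w≡) ⟩
          w + e₄          ∎))
        where
        open ≤-Reasoning
        lem : ∀ a b c → a + (b + c) ≡ c + a + b
        lem = solve-∀
      upper : e₄ ≤ p-upper n w k i j
      upper = ⊓-glb (⊓-glb (⊓-glb
        (≤-trans (m≤n+m e₄ e₃) (≤-reflexive (sym i≡)))
        (≤-trans (m≤n+m e₄ e₂) (≤-reflexive (sym j≡))))
        (≤-trans (m≤m+n e₄ e₁) (≤-reflexive (sym i+j∸k≡))))
        (≤-trans (ct≤sz false false true x z y) (≤-reflexive s₄≡))

  -- `p` is the intersection number of the Johnson scheme: y at half-distance i from x and j from z,
  -- sorted by its profile.
  ∑-pairs≤p : ∀ i j → ∑ (words n w) (λ y → δ (h x y) i * δ (h z y) j) ≤ p n w k i j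
  ∑-pairs≤p i j with k ≤? i + j
  ... | no k≰ = ≤-trans (∑-mono {g = const 0} {words n w} (All.map (λ {y} wy → δ*≤ {h x y} (λ hxy →
          ≤-trans (≤-reflexive (sym (*-identityʳ _))) (δ*≤ {h z y} (λ hzy → contradiction (k≤i+j wy hxy hzy) k≰)))) (words-weight n w)))
        (≤-trans (≤-reflexive (trans (∑-const 0 (words n w)) (*-zeroʳ (length (words n w))))) z≤n)
  ... | yes k≤ = begin
    ∑ (words n w) (λ y → δ (h x y) i * δ (h z y) j)
      ≤⟨ ∑-mono (All.map (λ {y} wy → δ*≤ {h x y} (λ hxy →
           ≤-trans (≤-reflexive (sym (*-identityʳ _))) (δ*≤ {h z y} (λ hzy → profile-counted wy hxy hzy)))) (words-weight n w)) ⟩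
    ∑ (words n w) (λ y → sumFromTo a b (prof y))
      ≤⟨ ∑-⊆ _ (filter-⊆ (λ y → weight y ≟ w) (allWords n)) ⟩
    ∑ (allWords n) (λ y → sumFromTo a b (prof y))
      ≡⟨ ∑-swap (λ y t → prof y (a + t)) (allWords n) (upTo (suc b ∸ a)) ⟩
    sumFromTo a b (λ l → ∑ (allWords n) (λ y → prof y l))
      ≡⟨ ∑-cong (upTo (suc b ∸ a)) (λ t → trans (∑-profile x z (i + j ∸ k ∸ (a + t)) (j ∸ (a + t)) (i ∸ (a + t)) (a + t))
                                                (binomials≡p-term i j (a + t))) ⟩
    sumFromTo a b (p-term n w k i j)
      ≡⟨ sym (p≡ n w k i j k≤) ⟩
    p n w k i j ∎
    where
    open ≤-Reasoning
    a = p-lower n w k i j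
    b = p-upper n w k i j
    prof : Vec Bool n → ℕ → ℕ
    prof y l = profile x z y (i + j ∸ k ∸ l) (j ∸ l) (i ∸ l) l

sz-self : ∀ {n} (x : Vec Bool n) → sz true false x x ≡ 0 × sz false true x x ≡ 0
sz-self []          = refl , refl
sz-self (true ∷ x)  = sz-self x
sz-self (false ∷ x) = sz-self x

-- The profile count at z = x: the two mixed cells are empty, and y trades i ones of x for i ones
-- outside.
sphere≤ : ∀ {n w} (x : Vec Bool n) → weight x ≡ w → ∀ i →
  ∑ (words n w) (λ y → δ (h x y) i) ≤ (w C i) * ((n ∸ w) C i)
sphere≤ {n} {w} x wx i = begin
  ∑ (words n w) (λ y → δ (h x y) i)
    ≤⟨ ∑-mono (All.map (λ {y} wy → ≤-trans (≤-reflexive (sym (*-identityʳ _)))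
         (δ*≤ {h x y} (λ hxy → ≤-reflexive (sym (one y wy hxy))))) (words-weight n w)) ⟩
  ∑ (words n w) (λ y → profile x x y i 0 0 i)
    ≤⟨ ∑-⊆ _ (filter-⊆ (λ y → weight y ≟ w) (allWords n)) ⟩
  ∑ (allWords n) (λ y → profile x x y i 0 0 i)
    ≡⟨ ∑-profile x x i 0 0 i ⟩
  binomials x x i 0 0 i
    ≡⟨ cong₂ _*_ (cong (_C i) s₁≡) (trans (+-identityʳ _) (trans (+-identityʳ _) (cong (_C i) s₄≡))) ⟩
  (w C i) * ((n ∸ w) C i) ∎
  where
  open ≤-Reasoning
  s₁≡ : sz true true x x ≡ w
  s₁≡ = trans (sym (+-identityʳ _)) (trans (cong (sz true true x x +_) (sym (proj₁ (sz-self x)))) (trans (sym (weight≡ˡ x x)) wx))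
  s₄≡ : sz false false x x ≡ n ∸ w
  s₄≡ = sym (trans (cong (_∸ w) (trans (size≡ x x) (cong₂ (λ a b → a + b + sz false false x x) wx (proj₂ (sz-self x)))))
    (trans (cong (λ a → a + sz false false x x ∸ w) (+-identityʳ w)) (m+n∸m≡n w _)))
  one : ∀ y → weight y ≡ w → h x y ≡ i → profile x x y i 0 0 i ≡ 1
  one y wy hxy = cong₂ _*_ (δ-refl e₁≡) (cong₂ _*_ (δ-refl e₂≡) (cong₂ _*_ (δ-refl e₃≡) (δ-refl e₄≡)))
    where
    e₂≡ : ct true false true x x y ≡ 0
    e₂≡ = n≤0⇒n≡0 (≤-trans (ct≤sz true false true x x y) (≤-reflexive (proj₁ (sz-self x))))
    e₃≡ : ct false true true x x y ≡ 0
    e₃≡ = n≤0⇒n≡0 (≤-trans (ct≤sz false true true x x y) (≤-reflexive (proj₂ (sz-self x))))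
    e₄≡ : ct false false true x x y ≡ i
    e₄≡ = trans (cong (_+ ct false false true x x y) (sym e₃≡)) (trans (sym (hˡ≡ x x y)) hxy)
    e₁≡ : ct true true false x x y ≡ i
    e₁≡ = +-cancelˡ-≡ w _ _ (trans (cong (_+ ct true true false x x y) (sym wy))
      (trans (weight-profile x x y) (cong₂ _+_ s₁≡ (trans (cong₂ (λ a b → a + b + ct false false true x x y) e₂≡ e₃≡) e₄≡))))

-- The graph of close words, with r = d - 1

module Johnson (n r w : ℕ) where

  adj : Vec Bool n → Vec Bool n → Bool
  adj x y = (1 ≤ᵇ dist x y) ∧ (dist x y <ᵇ 2 * suc r)

  adj-sym : ∀ x y → adj x y ≡ adj y x
  adj-sym x y = cong (λ m → (1 ≤ᵇ m) ∧ (m <ᵇ 2 * suc r)) (dist-sym x y)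

  adj-irrefl : ∀ x → adj x x ≡ false
  adj-irrefl x = cong (λ m → (1 ≤ᵇ m) ∧ (m <ᵇ 2 * suc r)) (dist-self x)

  open Graph adj adj-sym adj-irrefl public

  -- Between words of equal weight the distance is even, so adjacency means a half-distance from 1
  -- to r.
  e≤ : ∀ x y → weight x ≡ weight y → e x y ≤ sumFromTo 1 r (δ (h x y))
  e≤ x y wt = 𝟙≤ (adj x y) λ adj≡ →
    let pos , lt = Equivalence.to T-∧ (Equivalence.from T-≡ adj≡)
        d≡ = dist≡2h x y wt
    in ≤-trans (≤-reflexive (sym (δ-refl {h x y} refl))) (term≤sumFromTo (δ (h x y))
         (n≢0⇒n>0 (λ h≡0 → contradiction (subst (1 ≤_) (trans d≡ (cong (2 *_) h≡0)) (≤ᵇ⇒≤ 1 _ pos)) n≮0))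
         (≤-pred (*-cancelˡ-< 2 _ _ (subst (_< 2 * suc r) d≡ (<ᵇ⇒< _ _ lt)))))

  ¬adj⇒far : ∀ {x y} → x ≢ y → adj x y ≡ false → 2 * suc r ≤ dist x y
  ¬adj⇒far {x} {y} x≢y ¬adj with 2 * suc r ≤? dist x y
  ... | yes far = far
  ... | no ¬far = contradiction
    (trans (sym ¬adj) (Equivalence.to T-≡ (Equivalence.from T-∧ (≤⇒≤ᵇ (n≢0⇒n>0 (x≢y ∘ dist≡0⇒≡ x y)) , <⇒<ᵇ (≰⇒> ¬far)))))
    λ ()

  avoid≡1 : ∀ x K → avoid x K ≡ 1 → All (λ y → adj x y ≡ false) K
  avoid≡1 x []      _  = []
  avoid≡1 x (y ∷ K) av with adj x y in eq
  ... | false = eq ∷ avoid≡1 x K (trans (sym (+-identityʳ _)) av)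

  independent-far : ∀ {K} → Unique K → ind K ≡ 1 → AllPairs (λ x y → 2 * suc r ≤ dist x y) K
  independent-far []               _     = []
  independent-far {x ∷ K} (x∉ ∷ u) indep =
    All.zipWith (λ (x≢y , ¬a) → ¬adj⇒far x≢y ¬a) (x∉ , avoid≡1 x K (m*n≡1⇒m≡1 (avoid x K) (ind K) indep))
    ∷ independent-far u (m*n≡1⇒n≡1 (avoid x K) (ind K) indep)

  vertices : List (Vec Bool n)
  vertices = words n w

  weight-∈ : ∀ {x} → x ∈ vertices → weight x ≡ w
  weight-∈ = All.lookup (words-weight n w)

  independent⇒code : ∀ {I} → I ⊆ vertices → ind I ≡ 1 → IsCWCode n (2 * suc r) w I
  independent⇒code I⊆ indep = All-resp-⊆ I⊆ (words-weight n w) , independent-far (unique-⊆ I⊆ (words-unique n w)) indep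
    where
    unique-⊆ : ∀ {xs ys : List (Vec Bool n)} → xs ⊆ ys → Unique ys → Unique xs
    unique-⊆ []         []       = []
    unique-⊆ (y ∷ʳ p)   (_ ∷ u)  = unique-⊆ p u
    unique-⊆ (refl ∷ p) (y∉ ∷ u) = All-resp-⊆ p y∉ ∷ unique-⊆ p u

  -- `V` is the size of the closed ball; its term i = 0 is the centre, which the `suc` accounts for.
  degree< : ∀ {v} → v ∈ vertices → suc (∑ vertices (e v)) ≤ V n r w
  degree< {v} v∈ = ≤-trans (s≤s (begin
    ∑ vertices (e v)
      ≤⟨ ∑-mono (All.map (λ {y} wy → e≤ v y (trans (weight-∈ v∈) (sym wy))) (words-weight n w)) ⟩
    ∑ vertices (λ y → sumFromTo 1 r (δ (h v y)))
      ≡⟨ ∑-swap (λ y t → δ (h v y) (1 + t)) vertices (upTo r) ⟩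
    sumFromTo 1 r (λ i → ∑ vertices (λ y → δ (h v y) i))
      ≤⟨ ∑-mono′ (upTo r) (λ t → sphere≤ v (weight-∈ v∈) (1 + t)) ⟩
    sumFromTo 1 r (λ i → (w C i) * ((n ∸ w) C i)) ∎))
    (≤-reflexive (sym (sumFromTo-cons r (λ i → (w C i) * ((n ∸ w) C i)))))
    where open ≤-Reasoning

  ∑∑-product : ∀ (f g : ℕ → ℕ) xs ys → ∑ xs f * ∑ ys g ≡ ∑ xs (λ i → ∑ ys (λ j → f i * g j))
  ∑∑-product f g xs ys = trans (sym (∑-*ʳ (∑ ys g) f xs)) (∑-cong xs (λ i → sym (∑-*ˡ (f i) g ys)))

  -- Choose u at half-distance k from v, in (w C k)((n-w) C k) ways at most, then y at
  -- half-distances i from v and j from u, in at most `p n w k i j` ways. The pairs (u, y) are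
  -- ordered, so each edge counts twice.
  triangles≤ : ∀ {v} → v ∈ vertices → ∑ vertices (λ u → ∑ vertices (λ y → e v u * e v y * e u y)) ≤ sixE n r w
  triangles≤ {x} x∈ = begin
    ∑ vertices (λ z → ∑ vertices (λ y → e x z * e x y * e z y))
      ≤⟨ ∑-mono (All.map (λ {z} wz → perVertex z wz) (words-weight n w)) ⟩
    ∑ vertices (λ z → S (λ k → δ (h x z) k * Q k))
      ≡⟨ ∑-swap (λ z t → δ (h x z) (1 + t) * Q (1 + t)) vertices (upTo r) ⟩
    S (λ k → ∑ vertices (λ z → δ (h x z) k * Q k))
      ≡⟨ ∑-cong (upTo r) (λ t → ∑-*ʳ (Q (1 + t)) (λ z → δ (h x z) (1 + t)) vertices) ⟩
    S (λ k → ∑ vertices (λ z → δ (h x z) k) * Q k)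
      ≤⟨ ∑-mono′ (upTo r) (λ t → *-monoˡ-≤ (Q (1 + t)) (sphere≤ x wx (1 + t))) ⟩
    S (λ k → CC k * Q k)
      ≡⟨ ∑-cong (upTo r) (λ t → trans (sym (∑-*ˡ (CC (1 + t)) _ (upTo r)))
                                      (∑-cong (upTo r) (λ _ → sym (∑-*ˡ (CC (1 + t)) _ (upTo r))))) ⟩
    S (λ k → S (λ i → S (λ j → CC k * p n w k i j)))
      ≡⟨ ∑-swap (λ t t′ → S (λ j → CC (1 + t) * p n w (1 + t) (1 + t′) j)) (upTo r) (upTo r) ⟩
    S (λ i → S (λ k → S (λ j → CC k * p n w k i j)))
      ≡⟨ ∑-cong (upTo r) (λ t′ → ∑-swap (λ t t″ → CC (1 + t) * p n w (1 + t) (1 + t′) (1 + t″)) (upTo r) (upTo r)) ⟩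
    sixE n r w ∎
    where
    open ≤-Reasoning
    wx : weight x ≡ w
    wx = weight-∈ x∈
    S : (ℕ → ℕ) → ℕ
    S = sumFromTo 1 r
    CC Q : ℕ → ℕ
    CC k = (w C k) * ((n ∸ w) C k)
    Q k = S (λ i → S (λ j → p n w k i j))
    perVertex : ∀ z → weight z ≡ w → ∑ vertices (λ y → e x z * e x y * e z y) ≤ S (λ k → δ (h x z) k * Q k)
    perVertex z wz = begin
      ∑ vertices (λ y → e x z * e x y * e z y)
        ≤⟨ ∑-mono (All.map (λ {y} wy → *-mono-≤ (*-mono-≤ (e≤ x z (trans wx (sym wz))) (e≤ x y (trans wx (sym wy))))
                                                (e≤ z y (trans wz (sym wy)))) (words-weight n w)) ⟩
      ∑ vertices (λ y → S (δ (h x z)) * S (δ (h x y)) * S (δ (h z y)))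
        ≡⟨ trans (∑-cong vertices (λ y → *-assoc (S (δ (h x z))) (S (δ (h x y))) _))
                 (∑-*ˡ (S (δ (h x z))) (λ y → S (δ (h x y)) * S (δ (h z y))) vertices) ⟩
      S (δ (h x z)) * ∑ vertices (λ y → S (δ (h x y)) * S (δ (h z y)))
        ≡⟨ cong (S (δ (h x z)) *_) (trans (∑-cong vertices (λ y → ∑∑-product (λ t → δ (h x y) (1 + t)) (λ t → δ (h z y) (1 + t)) (upTo r) (upTo r)))
             (trans (∑-swap (λ y t → S (λ j → δ (h x y) (1 + t) * δ (h z y) j)) vertices (upTo r))
                    (∑-cong (upTo r) (λ t → ∑-swap (λ y t′ → δ (h x y) (1 + t) * δ (h z y) (1 + t′)) vertices (upTo r))))) ⟩
      S (δ (h x z)) * pairs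
        ≡⟨ sym (∑-*ʳ pairs (λ t → δ (h x z) (1 + t)) (upTo r)) ⟩
      S (λ k → δ (h x z) k * pairs)
        ≤⟨ ∑-mono′ (upTo r) (λ t → δ-mono (h x z) (1 + t) (λ hxz →
             ∑-mono′ (upTo r) (λ t′ → ∑-mono′ (upTo r) (λ t″ → ∑-pairs≤p x z wx wz hxz (1 + t′) (1 + t″))))) ⟩
      S (λ k → δ (h x z) k * Q k) ∎
      where
      pairs : ℕ
      pairs = S (λ i → S (λ j → ∑ vertices (λ y → δ (h x y) i * δ (h z y) j)))
      δ-mono : ∀ m k {a b} → (m ≡ k → a ≤ b) → δ m k * a ≤ δ m k * b
      δ-mono m k {a} {b} a≤b = δ*≤ (λ m≡k → ≤-trans (a≤b m≡k) (≤-reflexive (sym (trans (cong (_* b) (δ-refl m≡k)) (+-identityʳ b)))))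

-- The term i = j = k = 1 is positive: its `p` contains l = 0, with value w - 1, and 2 ≤ w brings
-- the lower limit down to 0.
sixE>0 : ∀ n r w → 1 ≤ r → 2 ≤ w → 2 * w ≤ n → 1 ≤ sixE n r w
sixE>0 n r w 1≤r 2≤w 2w≤n = begin
  1 * 1 * 1
    ≤⟨ *-mono-≤ (*-mono-≤ (≤-trans 1≤w (≤-reflexive (sym (nC1≡n w)))) (≤-trans 1≤n∸w (≤-reflexive (sym (nC1≡n (n ∸ w)))))) 1≤p ⟩
  (w C 1) * ((n ∸ w) C 1) * p n w 1 1 1
    ≤⟨ term≤sumFromTo (λ k → (w C k) * ((n ∸ w) C k) * p n w k 1 1) ≤-refl 1≤r ⟩
  sumFromTo 1 r (λ k → (w C k) * ((n ∸ w) C k) * p n w k 1 1)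
    ≤⟨ term≤sumFromTo (λ j → sumFromTo 1 r (λ k → (w C k) * ((n ∸ w) C k) * p n w k 1 j)) ≤-refl 1≤r ⟩
  sumFromTo 1 r (λ j → sumFromTo 1 r (λ k → (w C k) * ((n ∸ w) C k) * p n w k 1 j))
    ≤⟨ term≤sumFromTo (λ i → sumFromTo 1 r (λ j → sumFromTo 1 r (λ k → (w C k) * ((n ∸ w) C k) * p n w k i j))) ≤-refl 1≤r ⟩
  sixE n r w ∎
  where
  open ≤-Reasoning
  1≤w : 1 ≤ w
  1≤w = ≤-trans (s≤s z≤n) 2≤w
  1≤n∸w : 1 ≤ n ∸ w
  1≤n∸w = ≤-trans 1≤w (≤-trans (≤-reflexive (sym (trans (m+n∸m≡n w (w + 0)) (+-identityʳ w)))) (∸-monoˡ-≤ w 2w≤n))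
  1≤p : 1 ≤ p n w 1 1 1
  1≤p = begin
    1                    ≤⟨ ∸-monoˡ-≤ 1 2≤w ⟩
    w ∸ 1                ≡⟨ sym (nC1≡n (w ∸ 1)) ⟩
    (w ∸ 1) C 1          ≡⟨ sym (+-identityʳ _) ⟩
    p-term n w 1 1 1 0   ≤⟨ term≤sumFromTo (p-term n w 1 1 1) (≤-reflexive (m≤n⇒m∸n≡0 2≤w)) z≤n ⟩
    sumFromTo (p-lower n w 1 1 1) (p-upper n w 1 1 1) (p-term n w 1 1 1) ≡⟨ sym (p≡ n w 1 1 1 (s≤s z≤n)) ⟩
    p n w 1 1 1          ∎

-- Choice of the parameters

-- A discrete intermediate value principle, by descent from m. It supplies both the fugacity and c,
-- each with the failure of the preceding value.
crossing : ∀ (f : ℕ → ℕ) {X} m → X ≤ f m → X ≤ f 0 ⊎ ∃ λ t → f t < X × X ≤ f (suc t)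
crossing f zero    X≤ = inj₁ X≤
crossing f {X} (suc m) X≤ with X ≤? f m
... | yes X≤′ = crossing f m X≤′
... | no  X≰  = inj₂ (m , ≰⇒> X≰ , X≤)

n≤2^n : ∀ n → n ≤ 2 ^ n
n≤2^n zero    = z≤n
n≤2^n (suc n) = begin
  1 + n             ≤⟨ +-mono-≤ (m^n>0 2 n) (n≤2^n n) ⟩
  2 ^ n + 2 ^ n     ≡⟨ cong (2 ^ n +_) (sym (+-identityʳ _)) ⟩
  2 ^ suc n         ∎
  where open ≤-Reasoning

-- The N-th power of V²/e ≤ 2^(10c), with e = s/6, puts cN in the exponent, where 2VM replaces it.
integer-form : ∀ {N V s M} c → c * N ≤ 2 * V * M → 6 * (V * V) ≤ s * 2 ^ (10 * c) →
  6 ^ N * V ^ (2 * N) ≤ 2 ^ (20 * V * M) * s ^ N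
integer-form {N} {V} {s} {M} c cN≤ V²≤ = begin
  6 ^ N * V ^ (2 * N)             ≡⟨ cong (6 ^ N *_) (trans (sym (^-*-assoc V 2 N)) (cong (λ a → (V * a) ^ N) (*-identityʳ V))) ⟩
  6 ^ N * (V * V) ^ N             ≡⟨ sym (^-distribʳ-* N 6 (V * V)) ⟩
  (6 * (V * V)) ^ N               ≤⟨ ^-monoˡ-≤ N (≤-trans V²≤ (≤-reflexive (*-comm s (2 ^ (10 * c))))) ⟩
  (2 ^ (10 * c) * s) ^ N          ≡⟨ ^-distribʳ-* N (2 ^ (10 * c)) s ⟩
  (2 ^ (10 * c)) ^ N * s ^ N      ≡⟨ cong (_* s ^ N) (trans (^-*-assoc 2 (10 * c) N) (cong (2 ^_) (*-assoc 10 c N))) ⟩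
  2 ^ (10 * (c * N)) * s ^ N      ≤⟨ *-monoˡ-≤ (s ^ N) (^-monoʳ-≤ 2 (≤-trans (*-monoʳ-≤ 10 cN≤) (≤-reflexive (lem V M)))) ⟩
  2 ^ (20 * V * M) * s ^ N        ∎
  where
  open ≤-Reasoning
  lem : ∀ v m → 10 * (2 * v * m) ≡ 20 * v * m
  lem = solve-∀

-- The choice is q = 2t + 1, odd because `[1+1/q]^[q+1]≤4` wants q + 1 even. Then (q+1)² ≥ s, while
-- (2t)² < s gives q² ≤ 8t² + 2 ≤ 2s.
fugacity : ∀ s → 1 ≤ s → ∃ λ t → s ≤ 2 * suc t * (2 * suc t) × suc (2 * t) * suc (2 * t) ≤ 2 * s
fugacity s s>0 with crossing (λ t → 2 * t * (2 * t)) s (s≤ s)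
  where
  s≤ : ∀ s → s ≤ 2 * s * (2 * s)
  s≤ zero    = z≤n
  s≤ (suc s) = ≤-trans (m≤m+n (suc s) _) (m≤m*n (2 * suc s) (2 * suc s))
... | inj₁ s≤0 = contradiction (≤-trans s>0 s≤0) n≮0
... | inj₂ (t , t< , ≤t) = t , ≤t , (begin
  suc (2 * t) * suc (2 * t)             ≡⟨ lem₁ t ⟩
  4 * t + (4 * (t * t) + 1)             ≤⟨ +-monoˡ-≤ _ (*-monoʳ-≤ 4 (t≤t*t t)) ⟩
  4 * (t * t) + (4 * (t * t) + 1)       ≤⟨ m≤m+n _ 1 ⟩
  4 * (t * t) + (4 * (t * t) + 1) + 1   ≡⟨ lem₂ t ⟩
  2 * suc (2 * t * (2 * t))             ≤⟨ *-monoʳ-≤ 2 t< ⟩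
  2 * s                                 ∎)
  where
  open ≤-Reasoning
  t≤t*t : ∀ t → t ≤ t * t
  t≤t*t zero    = z≤n
  t≤t*t (suc t) = m≤m*n (suc t) (suc t)
  lem₁ : ∀ t → suc (2 * t) * suc (2 * t) ≡ 4 * t + (4 * (t * t) + 1)
  lem₁ = solve-∀
  lem₂ : ∀ t → 4 * (t * t) + (4 * (t * t) + 1) + 1 ≡ 2 * suc (2 * t * (2 * t))
  lem₂ = solve-∀

-- The case u = 0 (259 = 4⁴ + 3) is where the constants are nearly tight.
12g²≤1024^ : ∀ u → 12 * ((4 ^ (4 + u) + (3 + u)) * (4 ^ (4 + u) + (3 + u))) ≤ 2 ^ (10 * (2 + u))
12g²≤1024^ zero    = ≤ᵇ⇒≤ _ _ tt
12g²≤1024^ (suc u) = begin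
  12 * (g′ * g′)                    ≤⟨ *-monoʳ-≤ 12 (*-mono-≤ g′≤4g g′≤4g) ⟩
  12 * (4 * g * (4 * g))            ≡⟨ lem₁ g ⟩
  16 * (12 * (g * g))               ≤⟨ *-mono-≤ (≤ᵇ⇒≤ 16 1024 tt) (12g²≤1024^ u) ⟩
  2 ^ 10 * 2 ^ (10 * (2 + u))       ≡⟨ sym (^-distribˡ-+-* 2 10 (10 * (2 + u))) ⟩
  2 ^ (10 + 10 * (2 + u))           ≡⟨ cong (2 ^_) (sym (*-suc 10 (2 + u))) ⟩
  2 ^ (10 * (3 + u))                ∎
  where
  open ≤-Reasoning
  g = 4 ^ (4 + u) + (3 + u)
  g′ = 4 ^ (5 + u) + (4 + u)
  lem₁ : ∀ g → 12 * (4 * g * (4 * g)) ≡ 16 * (12 * (g * g))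
  lem₁ = solve-∀
  lem₂ : ∀ u → 4 * (3 + u) ≡ 4 + u + (8 + 3 * u)
  lem₂ = solve-∀
  g′≤4g : g′ ≤ 4 * g
  g′≤4g = begin
    4 * 4 ^ (4 + u) + (4 + u)         ≤⟨ +-monoʳ-≤ (4 * 4 ^ (4 + u)) (≤-trans (m≤m+n (4 + u) _) (≤-reflexive (sym (lem₂ u)))) ⟩
    4 * 4 ^ (4 + u) + 4 * (3 + u)     ≡⟨ sym (*-distribˡ-+ 4 (4 ^ (4 + u)) (3 + u)) ⟩
    4 * g                             ∎

-- By contraposition. The hypothesis is the failure of c = 2 + u and the conclusion is what
-- `local-bound` demands at c = 3 + u. The 12 in `12g²≤1024^` is the 6 of e = s/6 times the 2 of q²
-- ≤ 2s.
volume-large : ∀ {V s} q .{{_ : NonZero q}} u → q * q ≤ 2 * s → s * 2 ^ (10 * (2 + u)) < 6 * (V * V) →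
  q * 4 ^ suc (3 + u) + (3 + u) ≤ V
volume-large {V} {s} q u q²≤ <V with q * 4 ^ suc (3 + u) + (3 + u) ≤? V
... | yes ok = ok
... | no ¬ok = contradiction <V (≤⇒≯ (begin
  6 * (V * V)                         ≤⟨ *-monoʳ-≤ 6 (*-mono-≤ V≤ V≤) ⟩
  6 * (q * g * (q * g))               ≡⟨ lem₁ q g ⟩
  q * q * (6 * (g * g))               ≤⟨ *-monoˡ-≤ (6 * (g * g)) q²≤ ⟩
  2 * s * (6 * (g * g))               ≡⟨ lem₂ s g ⟩
  s * (12 * (g * g))                  ≤⟨ *-monoʳ-≤ s (12g²≤1024^ u) ⟩
  s * 2 ^ (10 * (2 + u))              ∎))
  where
  open ≤-Reasoning
  g = 4 ^ (4 + u) + (3 + u)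
  V≤ : V ≤ q * g
  V≤ = begin
    V                                 ≤⟨ <⇒≤ (≰⇒> ¬ok) ⟩
    q * 4 ^ (4 + u) + (3 + u)         ≤⟨ +-monoʳ-≤ (q * 4 ^ (4 + u)) (m≤n*m (3 + u) q) ⟩
    q * 4 ^ (4 + u) + q * (3 + u)     ≡⟨ sym (*-distribˡ-+ q (4 ^ (4 + u)) (3 + u)) ⟩
    q * g                             ∎
  lem₁ : ∀ q g → 6 * (q * g * (q * g)) ≡ q * q * (6 * (g * g))
  lem₁ = solve-∀
  lem₂ : ∀ s g → 2 * s * (6 * (g * g)) ≡ s * (12 * (g * g))
  lem₂ = solve-∀

-- Independent sets with the chosen parameters

module _ {A : Set} (adj : A → A → Bool) (adj-sym : ∀ x y → adj x y ≡ adj y x)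
         (adj-irrefl : ∀ x → adj x x ≡ false) where

  open Graph adj adj-sym adj-irrefl

  module _ (xs : List A) {D : ℕ} (deg< : ∀ {v} → v ∈ xs → suc (∑ xs (e v)) ≤ D) where

    -- Domination gives N ≤ D|I|; doubled, it has the form of the bound at c = 2.
    greedy-bound : ∃ λ I → I ⊆ xs × ind I ≡ 1 × 2 * length xs ≤ 2 * D * length I
    greedy-bound = let I , I⊆ , indep , dom = greedy xs in I , I⊆ , indep , (begin
      2 * length xs                           ≤⟨ *-monoʳ-≤ 2 dom ⟩
      2 * ∑ I (λ y → suc (∑ xs (e y)))        ≤⟨ *-monoʳ-≤ 2 (∑-mono {g = const D} (All-resp-⊆ I⊆ (All.tabulate deg<))) ⟩
      2 * ∑ I (const D)                       ≡⟨ cong (2 *_) (trans (∑-const D I) (*-comm (length I) D)) ⟩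
      2 * (D * length I)                      ≡⟨ sym (*-assoc 2 D (length I)) ⟩
      2 * D * length I                        ∎)
      where open ≤-Reasoning

    sparse-bound : ∀ {s} u → 1 ≤ s → s * 2 ^ (10 * (2 + u)) < 6 * (D * D) →
      (∀ {v} → v ∈ xs → ∑ xs (λ u → ∑ xs (λ u′ → e v u * e v u′ * e u u′)) ≤ s) →
      ∃ λ I → I ⊆ xs × ind I ≡ 1 × (3 + u) * length xs ≤ 2 * D * length I
    sparse-bound {s} u s>0 <X tri≤ =
      let t , s≤ , q²≤ = fugacity s s>0
      in large-independent (suc (2 * t)) {k = suc t} {c = 3 + u}
           (sym (*-suc 2 t)) (subst (λ b → s ≤ b * b) (*-suc 2 t) s≤) (volume-large {s = s} (suc (2 * t)) u q²≤ <X)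
           xs (λ v∈ → <⇒≤ (deg< v∈)) tri≤

    independence-bound : ∀ {s} → 1 ≤ s →
      (∀ {v} → v ∈ xs → ∑ xs (λ u → ∑ xs (λ u′ → e v u * e v u′ * e u u′)) ≤ s) →
      ∃ λ I → I ⊆ xs × ind I ≡ 1 ×
        6 ^ length xs * D ^ (2 * length xs) ≤ 2 ^ (20 * D * length I) * s ^ length xs
    independence-bound {s} s>0 tri≤ = choose (crossing f X X≤fX)
      where
      open ≤-Reasoning
      X = 6 * (D * D)
      -- The index u stands for c = 2 + u, so `f 0` is the last case served by the greedy set.
      f : ℕ → ℕ
      f u = s * 2 ^ (10 * (2 + u))
      X≤fX : X ≤ f X
      X≤fX = begin
        X                              ≤⟨ n≤2^n X ⟩
        2 ^ X                          ≤⟨ ^-monoʳ-≤ 2 (≤-trans (m≤n+m X 2) (m≤n*m (2 + X) 10)) ⟩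
        2 ^ (10 * (2 + X))             ≤⟨ m≤n*m _ s {{>-nonZero s>0}} ⟩
        f X                            ∎
      conclude : ∀ c → X ≤ s * 2 ^ (10 * c) → (∃ λ I → I ⊆ xs × ind I ≡ 1 × c * length xs ≤ 2 * D * length I) →
        ∃ λ I → I ⊆ xs × ind I ≡ 1 × 6 ^ length xs * D ^ (2 * length xs) ≤ 2 ^ (20 * D * length I) * s ^ length xs
      conclude c X≤ (I , I⊆ , indep , large) = I , I⊆ , indep , integer-form {M = length I} c large X≤
      choose : X ≤ f 0 ⊎ (∃ λ u → f u < X × X ≤ f (suc u)) →
        ∃ λ I → I ⊆ xs × ind I ≡ 1 × 6 ^ length xs * D ^ (2 * length xs) ≤ 2 ^ (20 * D * length I) * s ^ length xs
      choose (inj₁ X≤)            = conclude 2 X≤ greedy-bound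
      choose (inj₂ (u , <X , X≤)) = conclude (3 + u) X≤ (sparse-bound u s>0 <X tri≤)

-- With N = n C w, taking binary logarithms gives N (2 log V - log e) ≤ 20 V M, where e = sixE/6
-- accounts for 6^N. For d = 1 the sum e is empty and has no logarithm, hence 2 ≤ d.
theorem15 : (n d w : ℕ) → 2 ≤ d → d ≤ w → 2 * w ≤ n →
    Σ ℕ λ M → (M ≤A[ n , 2 * d , w ]) ×
    (6 ^ (n C w) * V n (d ∸ 1) w ^ (2 * (n C w))
    ≤ 2 ^ (20 * V n (d ∸ 1) w * M) * sixE n (d ∸ 1) w ^ (n C w))
theorem15 n (suc r) w 2≤d d≤w 2w≤n =
  let I , I⊆ , indep , bound = independence-bound adj adj-sym adj-irrefl vertices degree<
        (sixE>0 n r w (≤-pred 2≤d) (≤-trans 2≤d d≤w) 2w≤n) triangles≤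
  in length I , (I , independent⇒code I⊆ indep , ≤-refl) ,
     subst (λ N → 6 ^ N * V n r w ^ (2 * N) ≤ 2 ^ (20 * V n r w * length I) * sixE n r w ^ N) (length-words n w) bound
  where open Johnson n r w
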